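{- In the setting described in the context, for all partitions $\lambda^{(1)},\dots,\lambda^{(N)}$, $$ \mathrm{Prob}\big(\lambda(v_i)=\lambda^{(i)}\ \text{for } 1\le i\le N\big)=\frac1Z\, s_{\lambda^{(1)}}(X^-_1)\,\prod_{i=1}^{N-1}\Big(\sum_{\nu} s_{\lambda^{(i)}/\nu}(X^+_i)\, s_{\lambda^{(i+1)}/\nu}(X^-_{i+1})\Big)\, s_{\lambda^{(N)}}(X^+_N), $$ where the sum is over all partitions $\nu$, $X^-_i=(x^-_m)_{m\in\mathbb Z+\frac12,\ u_{i-1}<m<v_i}$ and $X^+_i=(x^+_m)_{m\in\mathbb Z+\frac12,\ v_i<m<u_i}$. That is, the joint law of $(\lambda(v_1),\dots,\lambda(v_N))$ is a Schur process whose parameters are the polynomial specializations $X^\pm_i$.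
   Context: Fix an integer $N\ge1$ and integers $u_0<v_1<u_1<v_2<\dots<u_{N-1}<v_N<u_N$. For each integer $t$ with $u_0<t<u_N$ fix $q_t\in(0,1)$. For a half-integer $m\in(\mathbb Z+\frac12)\cap(u_0,u_N)$ write $m\in D^+$ if $v_i<m<u_i$ for some $1\le i\le N$, and $m\in D^-$ if $u_{i-1}<m<v_i$ for some $1\le i\le N$. For partitions, $\lambda\succ\mu$ (equivalently $\mu\prec\lambda$) means $\lambda_1\ge\mu_1\ge\lambda_2\ge\mu_2\ge\cdots$. A configuration is a sequence of partitions $(\lambda(t))_{t\in\mathbb Z}$ such that: - $\lambda(t)=\emptyset$ for $t\le u_0$ and for $t\ge u_N$; - for every half-integer $m\in(u_0,u_N)$: if $m\in D^-$ then $\lambda(m-\frac12)\prec\lambda(m+\frac12)$, and if $m\in D^+$ then $\lambda(m-\frac12)\succ\lambda(m+\frac12)$. These are exactly the sequences of diagonal slices of skew plane partitions with given inner shape (corners at the $v_i,u_i$) inside a box. The weight of a configuration is $W=\prod_{u_0<t<u_N} q_t^{|\lambda(t)|}$, where $|\lambda|=\sum_i\lambda_i$. The partition function is $Z=\sum W$ over all configurations, and the probability of a configuration is $W/Z$. Put $x^+_m=\prod_{t\in\mathbb Z,\,u_0<t<m}q_t$ and $x^-_m=(x^+_m)^{ -1}$ for half-integers $m$. Here $s_{\lambda/\mu}(x_1,\dots,x_n)$ is the skew Schur polynomial, which is zero unless $\mu\subset\lambda$, and $s_\lambda=s_{\lambda/\emptyset}$. -}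

module Defs where

open import Level using (0ℓ)
open import Algebra.Bundles using (CommutativeRing; Semiring)
open import Data.Nat.Base as ℕ using (ℕ; zero; suc)
import Data.Nat.Properties as ℕₚ
open import Data.Nat.ListAction using (sum)
open import Data.Integer.Base as ℤ using (ℤ; +_; 1ℤ; 0ℤ)
open import Data.Fin.Base as Fin using (Fin; inject₁; fromℕ)
import Data.Fin.Properties as Finₚ
open import Data.List.Base as List
  using (List; []; _∷_; map; foldr; filter; concatMap; allFin; upTo; length; reverse)
open import Data.List.Relation.Unary.All as All using (All)
open import Data.List.Relation.Unary.Linked using (Linked; [])
import Data.List.Relation.Unary.Unique.Setoid as UniqueSetoid
open import Data.Product.Base using (Σ-syntax; ∃-syntax; _×_; _,_; proj₁; proj₂)
open import Data.Vec.Base as Vec using (Vec; []; _∷_)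
open import Relation.Binary.Bundles using (Setoid)
open import Relation.Binary.Structures using (IsTotalOrder)
import Relation.Binary.Construct.On as On
open import Relation.Binary.PropositionalEquality using (_≡_; setoid; _→-setoid_)
open import Relation.Nullary using (¬_; Dec; yes; no)
open import Relation.Nullary.Decidable using (_×-dec_; _→-dec_)
open import Relation.Unary using (Pred; U)
import Algebra.Definitions.RawSemiring as RawSemiringDefinitions

-- The real numbers: a Dedekind-complete totally ordered field.
--
-- ⨆ and _⁻¹ are total functions; only the values ⨆ P for P inhabited and
-- bounded above, and x ⁻¹ for x ≉ 0#, are specified.

record RealField : Set₁ where
  field
    commutativeRing : CommutativeRing 0ℓ 0ℓ

  open CommutativeRing commutativeRing public
    hiding (zero)

  infix  4 _≤_ _<_
  infix  8 _⁻¹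

  field
    _≤_          : Carrier → Carrier → Set
    isTotalOrder : IsTotalOrder _≈_ _≤_
    +-monoˡ-≤    : ∀ z {x y} → x ≤ y → x + z ≤ y + z
    *-nonNeg     : ∀ {x y} → 0# ≤ x → 0# ≤ y → 0# ≤ x * y
    0≉1          : ¬ 0# ≈ 1#
    _⁻¹          : Carrier → Carrier
    ⁻¹-cong      : ∀ {x y} → x ≈ y → x ⁻¹ ≈ y ⁻¹
    ⁻¹-inverseʳ  : ∀ {x} → ¬ x ≈ 0# → x * x ⁻¹ ≈ 1#

  _<_ : Carrier → Carrier → Set
  x < y = x ≤ y × ¬ x ≈ y

  IsUpperBound : Pred Carrier 0ℓ → Carrier → Set
  IsUpperBound P b = ∀ {x} → P x → x ≤ b

  IsSupremum : Pred Carrier 0ℓ → Carrier → Set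
  IsSupremum P s = IsUpperBound P s × (∀ {b} → IsUpperBound P b → s ≤ b)

  field
    ⨆            : Pred Carrier 0ℓ → Carrier
    ⨆-isSupremum : ∀ P → (∃[ x ] P x) → (∃[ b ] IsUpperBound P b) →
                   IsSupremum P (⨆ P)

  open RawSemiringDefinitions (Semiring.rawSemiring semiring) public using (_^_)

  infixl 7 _/_
  _/_ : Carrier → Carrier → Carrier
  x / y = x * y ⁻¹

  ∑-list ∏-list : {A : Set} → List A → (A → Carrier) → Carrier
  ∑-list as f = foldr (λ a s → f a + s) 0# as
  ∏-list as f = foldr (λ a p → f a * p) 1# as

  -- The values of the sums of f over finite sets of elements of I
  -- satisfying P.
  FiniteSubsum : (I : Setoid 0ℓ 0ℓ) → Pred (Setoid.Carrier I) 0ℓ →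
                 (Setoid.Carrier I → Carrier) → Pred Carrier 0ℓ
  FiniteSubsum I P f x =
    Σ[ is ∈ List (Setoid.Carrier I) ] Unique is × All P is × x ≈ ∑-list is f
    where open UniqueSetoid I using (Unique)

  -- The sum of f over all elements of I satisfying P, for f ≥ 0, as the
  -- supremum of the finite subsums.
  ∑⁺ : (I : Setoid 0ℓ 0ℓ) → Pred (Setoid.Carrier I) 0ℓ →
       (Setoid.Carrier I → Carrier) → Carrier
  ∑⁺ I P f = ⨆ (FiniteSubsum I P f)

record Partition : Set where
  constructor mkPartition
  field
    parts    : List ℕ
    sorted   : Linked ℕ._≥_ parts
    positive : All (0 ℕ.<_) parts

open Partition public

partitions : Setoid 0ℓ 0ℓ
partitions = setoid Partition

∅ : Partition
∅ = mkPartition [] [] All.[]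

size : Partition → ℕ
size κ = sum (parts κ)

nth : List ℕ → ℕ → ℕ
nth []       _       = 0
nth (k ∷ ks) zero    = k
nth (k ∷ ks) (suc i) = nth ks i

-- part κ i is κ_{i+1}: rows (and below, columns) are counted from 0.
part : Partition → ℕ → ℕ
part κ = nth (parts κ)

infix 4 _≻_ _≺_ _⊆_ _⊆?_

_≻_ _≺_ : Partition → Partition → Set
κ ≻ μ = ∀ i → (part κ i ℕ.≥ part μ i) × (part μ i ℕ.≥ part κ (suc i))
μ ≺ κ = κ ≻ μ

-- Only the nonzero parts of μ impose a condition.
_⊆_ : Partition → Partition → Set
μ ⊆ κ = All (λ i → part μ i ℕ.≤ part κ i) (upTo (length (parts μ)))

_⊆?_ : ∀ μ κ → Dec (μ ⊆ κ)
μ ⊆? κ = All.all? (λ i → part μ i ℕₚ.≤? part κ i) (upTo (length (parts μ)))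

cells : Partition → Partition → List (ℕ × ℕ)
cells κ μ =
  concatMap (λ i → map (i ,_) (filter (part μ i ℕₚ.≤?_) (upTo (part κ i))))
            (upTo (length (parts κ)))

-- A filling assigns an entry in Fin n to each position in the list of cells.
module _ (cs : List (ℕ × ℕ)) {n : ℕ} where

  row col : Fin (length cs) → ℕ
  row p = proj₁ (List.lookup cs p)
  col p = proj₂ (List.lookup cs p)

  Semistandard : Vec (Fin n) (length cs) → Set
  Semistandard T = ∀ p q →
      (row p ≡ row q → col p ℕ.≤ col q → Vec.lookup T p Fin.≤ Vec.lookup T q)
    × (col p ≡ col q → row p ℕ.< row q → Vec.lookup T p Fin.< Vec.lookup T q)

  semistandard? : ∀ T → Dec (Semistandard T)
  semistandard? T = Finₚ.all? λ p → Finₚ.all? λ q →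
      ((row p ℕₚ.≟ row q) →-dec ((col p ℕₚ.≤? col q) →-dec
        (Vec.lookup T p Finₚ.≤? Vec.lookup T q)))
    ×-dec
      ((col p ℕₚ.≟ col q) →-dec ((row p ℕₚ.<? row q) →-dec
        (Vec.lookup T p Finₚ.<? Vec.lookup T q)))

fillings : ∀ n k → List (Vec (Fin n) k)
fillings n zero    = [] ∷ []
fillings n (suc k) = concatMap (λ a → map (a ∷_) (fillings n k)) (allFin n)

tableaux : (κ μ : Partition) (n : ℕ) → List (Vec (Fin n) (length (cells κ μ)))
tableaux κ μ n =
  filter (semistandard? (cells κ μ)) (fillings n (length (cells κ μ)))

module _ (R : RealField) where

  open RealField R

  skewSchur : Partition → Partition → List Carrier → Carrier
  skewSchur κ μ xs with μ ⊆? κ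
  ... | no  _ = 0#
  ... | yes _ = ∑-list (tableaux κ μ (length xs))
                       (λ T → ∏-list (Vec.toList T) (List.lookup xs))

  schur : Partition → List Carrier → Carrier
  schur κ = skewSchur κ ∅

-- k +½ is the half-integer k + ½.
record HalfInteger : Set where
  constructor _+½
  field floor : ℤ

open HalfInteger public

infix 4 _<½_ _½<_

-- t < m and m < t, for an integer t and a half-integer m.
_<½_ : ℤ → HalfInteger → Set
t <½ m = t ℤ.≤ floor m

_½<_ : HalfInteger → ℤ → Set
m ½< t = floor m ℤ.< t

-- m − ½ and m + ½.
pred½ succ½ : HalfInteger → ℤ
pred½ m = floor m
succ½ m = floor m ℤ.+ 1ℤ

-- The integers t with a ≤ t < b, in increasing order.
[_,_⟩ : ℤ → ℤ → List ℤ
[ a , b ⟩ = map (λ j → a ℤ.+ + j) (upTo ℤ.∣ (b ℤ.- a) ℤ.⊔ 0ℤ ∣)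

-- The half-integers m with a < m < b, in increasing order.
halfIntegers : ℤ → ℤ → List HalfInteger
halfIntegers a b = map _+½ [ a , b ⟩

-- u i is u_i, and v i is v_{i+1}.
record Corners (N : ℕ) : Set where
  field
    u   : Fin (suc N) → ℤ
    v   : Fin N → ℤ
    u<v : ∀ i → u (inject₁ i) ℤ.< v i
    v<u : ∀ i → v i ℤ.< u (Fin.suc i)

  uFirst uLast : ℤ
  uFirst = u Fin.zero
  uLast  = u (fromℕ N)

  D⁺ D⁻ : HalfInteger → Set
  D⁺ m = ∃[ i ] (v i <½ m × m ½< u (Fin.suc i))
  D⁻ m = ∃[ i ] (u (inject₁ i) <½ m × m ½< v i)

  record Configuration : Set where
    field
      slice    : ℤ → Partition
      empty-≤  : ∀ t → t ℤ.≤ uFirst → slice t ≡ ∅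
      empty-≥  : ∀ t → uLast ℤ.≤ t → slice t ≡ ∅
      interlace : ∀ m → uFirst <½ m → m ½< uLast →
                    (D⁻ m → slice (pred½ m) ≺ slice (succ½ m))
                  × (D⁺ m → slice (pred½ m) ≻ slice (succ½ m))

  open Configuration public

  configurations : Setoid 0ℓ 0ℓ
  configurations = On.setoid (ℤ →-setoid Partition) slice

module Ensemble (R : RealField) {N : ℕ} (C : Corners N)
                (q : ℤ → RealField.Carrier R) where

  open RealField R
  open Corners C

  weight : Configuration → Carrier
  weight c = ∏-list [ uFirst ℤ.+ 1ℤ , uLast ⟩ (λ t → q t ^ size (slice c t))

  Z : Carrier
  Z = ∑⁺ configurations U weight

  Prob : Pred Configuration 0ℓ → Carrier
  Prob E = ∑⁺ configurations E weight / Z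

  x⁺ x⁻ : HalfInteger → Carrier
  x⁺ m = ∏-list [ uFirst ℤ.+ 1ℤ , succ½ m ⟩ q
  x⁻ m = x⁺ m ⁻¹

  -- Schur polynomials are symmetric, so the order in which these families
  -- are listed is immaterial.
  X⁻ X⁺ : Fin N → List Carrier
  X⁻ i = map x⁻ (halfIntegers (u (inject₁ i)) (v i))
  X⁺ i = map x⁺ (reverse (halfIntegers (v i) (u (Fin.suc i))))

{-# OPTIONS --safe #-}
-- A configuration is a path of partitions, and W is a product of one factor per
-- step.  Summation by parts in the exponents turns ∏ q_t^|λ(t)| into
-- ∏ (x⁻_m)^|λ(m+½)/λ(m-½)| over D⁻ times ∏ (x⁺_m)^|λ(m-½)/λ(m+½)| over D⁺.  Once
-- the λ(v_i) are fixed, every slice is contained in one of them, so all sums run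
-- over a finite order ideal of partitions and become products of transfer
-- matrices.  Fixing λ(v_i) makes the product over (u_{i-1}, u_i) a matrix of rank
-- one, whose two factors are sums over chains of interlacing partitions, that
-- is, skew Schur polynomials.
module Submission where

open import Defs
open import Level using (0ℓ)
open import Algebra.Bundles using (CommutativeMonoid)
import Algebra.Properties.CommutativeSemigroup as CommutativeSemigroupProperties
open import Data.Bool.Base using (if_then_else_)
open import Data.Empty using (⊥; ⊥-elim)
open import Data.Fin as Fin using (Fin; toℕ; fromℕ<; inject₁; fromℕ)
import Data.Fin.Properties as Finₚ
open import Data.Integer as ℤ using (ℤ; +_; 0ℤ; 1ℤ)
import Data.Integer.Properties as ℤₚ
open import Data.List as List
  using (List; []; _∷_; [_]; _++_; map; foldr; filter; concat; concatMap; length; upTo;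
         reverse; tabulate; allFin; deduplicate; cartesianProductWith)
import Data.List.Properties as Listₚ
open import Data.List.Membership.Propositional using (_∈_)
open import Data.List.Membership.Propositional.Properties
open import Data.List.Membership.Propositional.Properties.WithK using (unique∧set⇒bag)
open import Data.List.Relation.Binary.BagAndSetEquality using (∼bag⇒↭)
open import Data.List.Relation.Binary.Permutation.Propositional as ↭ using (_↭_)
open import Data.List.Relation.Binary.Permutation.Propositional.Properties using (shift)
open import Data.List.Relation.Unary.All as All using (All; []; _∷_)
open import Data.List.Relation.Unary.AllPairs using ([]; _∷_)
open import Data.List.Relation.Unary.Any as Any using (here; there)
import Data.List.Relation.Unary.Any.Properties as Anyₚ
open import Data.List.Relation.Unary.Linked as Linked using (Linked; []; [-]; _∷_)
open import Data.List.Relation.Unary.Unique.Propositional using (Unique)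
import Data.List.Relation.Unary.Unique.Propositional.Properties as Uniqueₚ
import Data.List.Relation.Unary.Unique.DecPropositional.Properties as UniqueDec
import Data.List.Relation.Unary.Unique.Setoid as UniqueSetoid
open import Data.Nat as ℕ using (ℕ; zero; suc; z≤n; s≤s)
open import Data.Nat.ListAction using (sum)
import Data.Nat.Properties as ℕₚ
open import Data.Product using (∃-syntax; _×_; _,_; proj₁; proj₂)
open import Data.Sum using (_⊎_; inj₁; inj₂)
open import Data.Unit using (tt)
open import Data.Vec as Vec using (Vec; []; _∷_)
import Data.Vec.Properties as Vecₚ
open import Function.Base using (_∘_; id; flip)
open import Function.Bundles using (mk⇔)
open import Relation.Binary.Bundles using (Setoid)
open import Relation.Binary.Definitions using (DecidableEquality; tri<; tri≈; tri>)
open import Relation.Binary.PropositionalEquality as ≡ using (_≡_; _≢_)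
import Relation.Binary.Reasoning.Setoid as SetoidReasoning
open import Relation.Binary.Structures using (IsTotalOrder)
open import Relation.Nullary using (¬_; Dec; yes; no; does)
open import Relation.Nullary.Decidable using (map′; _×-dec_; _⊎-dec_; _→-dec_)
open import Relation.Unary using (Pred; Decidable; U)

-- Finite sums and products

-- Every infinite sum is defined as a supremum of finite subsums, so each one has to be exhibited as
-- a maximum. The pinned configurations, and the partitions ν with nonzero summand, are therefore
-- matched with repetition-free lists drawn from one finite ideal `B`, a rectangle containing all
-- prescribed partitions. The parameters come from q_t = x⁺_{t+½} / x⁺_{t-½}. Regrouping the product
-- of these quotients by steps leaves x⁺_m with exponent |λ(m-½)| - |λ(m+½)|, whose sign is decided
-- by D⁺ or D⁻; the boundary terms vanish because the end slices are empty. A step along a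
-- horizontal strip then has the weight of a one-variable skew Schur polynomial. Stretches in D⁻ are
-- read forwards and stretches in D⁺ backwards, so that both become increasing chains. Such a chain
-- corresponds to a tableau by recording when each cell appears. The normalisation `Z` is the same
-- factor on both sides, so the work lies in the numerator.

module BigOp (M : CommutativeMonoid 0ℓ 0ℓ) where
  open CommutativeMonoid M
  open SetoidReasoning setoid
  open CommutativeSemigroupProperties commutativeSemigroup using (interchange)

  private variable
    A B : Set

  big : List A → (A → Carrier) → Carrier
  big as f = foldr (λ a s → f a ∙ s) ε as

  big-cong : ∀ (as : List A) {f g} → (∀ a → a ∈ as → f a ≈ g a) → big as f ≈ big as g
  big-cong []       f≈g = refl
  big-cong (a ∷ as) f≈g = ∙-cong (f≈g a (here ≡.refl)) (big-cong as (λ b → f≈g b ∘ there))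

  big-ε : ∀ (as : List A) {f} → (∀ a → a ∈ as → f a ≈ ε) → big as f ≈ ε
  big-ε []       f≈ε = refl
  big-ε (a ∷ as) f≈ε =
    trans (∙-cong (f≈ε a (here ≡.refl)) (big-ε as (λ b → f≈ε b ∘ there))) (identityˡ ε)

  big-∙ : ∀ (as : List A) f g → big as (λ a → f a ∙ g a) ≈ big as f ∙ big as g
  big-∙ []       f g = sym (identityˡ ε)
  big-∙ (a ∷ as) f g = trans (∙-congˡ (big-∙ as f g)) (interchange _ _ _ _)

  big-++ : ∀ (as bs : List A) f → big (as ++ bs) f ≈ big as f ∙ big bs f
  big-++ []       bs f = sym (identityˡ _)
  big-++ (a ∷ as) bs f = trans (∙-congˡ (big-++ as bs f)) (sym (assoc _ _ _))

  big-map : ∀ (h : A → B) as f → big (map h as) f ≈ big as (f ∘ h)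
  big-map h []       f = refl
  big-map h (a ∷ as) f = ∙-congˡ (big-map h as f)

  big-concatMap : ∀ (h : A → List B) as f →
                  big (concatMap h as) f ≈ big as (λ a → big (h a) f)
  big-concatMap h []       f = refl
  big-concatMap h (a ∷ as) f =
    trans (big-++ (h a) (concatMap h as) f) (∙-congˡ (big-concatMap h as f))

  big-swap : ∀ (as : List A) (bs : List B) (f : A → B → Carrier) →
             big as (λ a → big bs (f a)) ≈ big bs (λ b → big as (λ a → f a b))
  big-swap []       bs f = sym (big-ε bs (λ _ _ → refl))
  big-swap (a ∷ as) bs f =
    trans (∙-congˡ (big-swap as bs f)) (sym (big-∙ bs (f a) (λ b → big as (λ a → f a b))))

  big-↭ : ∀ {as bs : List A} f → as ↭ bs → big as f ≈ big bs f
  big-↭ f ↭.refl          = refl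
  big-↭ f (↭.prep a p)    = ∙-congˡ (big-↭ f p)
  big-↭ f (↭.swap a b p)  = begin
    f a ∙ (f b ∙ _)  ≈⟨ ∙-congˡ (∙-congˡ (big-↭ f p)) ⟩
    f a ∙ (f b ∙ _)  ≈⟨ assoc _ _ _ ⟨
    (f a ∙ f b) ∙ _  ≈⟨ ∙-congʳ (comm _ _) ⟩
    (f b ∙ f a) ∙ _  ≈⟨ assoc _ _ _ ⟩
    f b ∙ (f a ∙ _)  ∎
  big-↭ f (↭.trans p q)   = trans (big-↭ f p) (big-↭ f q)

  infixl 9 _when_
  -- The default is the neutral element: 0 where sums are formed, 1 where products are formed.
  _when_ : {P : Set} → Carrier → Dec P → Carrier
  x when d = if does d then x else ε

  when-yes : ∀ {P : Set} {x} (d : Dec P) → P → x when d ≈ x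
  when-yes (yes _) p = refl
  when-yes (no ¬p) p = ⊥-elim (¬p p)

  when-no : ∀ {P : Set} {x} (d : Dec P) → ¬ P → x when d ≈ ε
  when-no (yes p) ¬p = ⊥-elim (¬p p)
  when-no (no _)  ¬p = refl

  when-cong : ∀ {P Q : Set} {x y} (d : Dec P) (e : Dec Q) → (P → Q) → (Q → P) →
              (P → x ≈ y) → x when d ≈ y when e
  when-cong (yes p) e P→Q Q→P x≈y = trans (x≈y p) (sym (when-yes e (P→Q p)))
  when-cong (no ¬p) e P→Q Q→P x≈y = sym (when-no e (¬p ∘ Q→P))

  big-filter : ∀ {P : Pred A 0ℓ} (P? : Decidable P) as f →
               big (filter P? as) f ≈ big as (λ a → f a when P? a)
  big-filter P? []       f = refl
  big-filter P? (a ∷ as) f with P? a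
  ... | yes _ = ∙-congˡ (big-filter P? as f)
  ... | no  _ = trans (big-filter P? as f) (sym (identityˡ _))

  big-single : ∀ {as : List A} {f} a → Unique as → a ∈ as →
               (∀ b → b ≢ a → f b ≈ ε) → big as f ≈ f a
  big-single {as = _ ∷ as} a (a∉ ∷ as!) (here ≡.refl) f≈ε =
    trans (∙-congˡ (big-ε as (λ b b∈ → f≈ε b (λ b≡a → All.lookup a∉ b∈ (≡.sym b≡a)))))
          (identityʳ _)
  big-single {as = b ∷ as} a (b∉ ∷ as!) (there a∈) f≈ε =
    trans (∙-cong (f≈ε b (All.lookup b∉ a∈)) (big-single a as! a∈ f≈ε)) (identityˡ _)

module _ (M : CommutativeMonoid 0ℓ 0ℓ) {A B : Set} (R : A → B → Set) where
  open CommutativeMonoid M using (_≈_; Carrier; refl; trans; ∙-cong)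
  open BigOp M

  private
    transport : ∀ {f : A → Carrier} {g : B → Carrier} as {bs} → Unique as →
      (∀ {a} → a ∈ as → ∃[ b ] (b ∈ bs × R a b)) →
      (∀ {a a′ b} → a ∈ as → a′ ∈ as → R a b → R a′ b → a ≡ a′) →
      (∀ {a b} → a ∈ as → R a b → f a ≈ g b) →
      ∃[ cs ] (Unique cs × (∀ {b} → b ∈ cs → b ∈ bs × (∃[ a ] (a ∈ as × R a b))) ×
               (∀ {a} → a ∈ as → ∃[ b ] (b ∈ cs × R a b)) ×
               big as f ≈ big cs g)
    transport []       as!        tot inj f≈g = [] , [] , (λ ()) , (λ ()) , refl
    transport (a ∷ as) (a∉ ∷ as!) tot inj f≈g
      with b , b∈ , Rab ← tot (here ≡.refl)
      with cs , cs! , cs→ , →cs , eq ←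
           transport as as! (tot ∘ there) (λ p q → inj (there p) (there q)) (f≈g ∘ there)
      = b ∷ cs
      , All.tabulate (λ {c} c∈ b≡c → let a′ , a′∈ , Ra′c = proj₂ (cs→ c∈) in
          All.lookup a∉ a′∈
            (inj (here ≡.refl) (there a′∈) Rab (≡.subst (R a′) (≡.sym b≡c) Ra′c)))
        ∷ cs!
      , (λ { (here ≡.refl) → b∈ , a , here ≡.refl , Rab
           ; (there c∈) → let c∈bs , a′ , a′∈ , Ra′c = cs→ c∈ in c∈bs , a′ , there a′∈ , Ra′c })
      , (λ { (here ≡.refl) → b , here ≡.refl , Rab
           ; (there a′∈) → let c , c∈ , Rac = →cs a′∈ in c , there c∈ , Rac })
      , ∙-cong (f≈g (here ≡.refl) Rab) eq

  -- The correspondence is a relation, so neither direction has to be given as a function. Choosing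
  -- a partner for each member of `as` yields a repetition-free list with the same total; it has the
  -- same members as `bs`, hence is a permutation of it.
  big-bijection : ∀ {as bs} {f : A → Carrier} {g : B → Carrier} → Unique as → Unique bs →
    (∀ {a} → a ∈ as → ∃[ b ] (b ∈ bs × R a b)) →
    (∀ {b} → b ∈ bs → ∃[ a ] (a ∈ as × R a b)) →
    (∀ {a a′ b} → a ∈ as → a′ ∈ as → R a b → R a′ b → a ≡ a′) →
    (∀ {a b b′} → b ∈ bs → b′ ∈ bs → R a b → R a b′ → b ≡ b′) →
    (∀ {a b} → a ∈ as → R a b → f a ≈ g b) →
    big as f ≈ big bs g
  big-bijection {as} {bs} {f} {g} as! bs! tot surj inj fun f≈g
    with cs , cs! , cs→ , →cs , eq ← transport {f} {g} as as! tot inj f≈g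
    = trans eq
        (big-↭ g (∼bag⇒↭ (unique∧set⇒bag cs! bs! (mk⇔ (λ c∈ → proj₁ (cs→ c∈)) back))))
    where
    back : ∀ {b} → b ∈ bs → b ∈ cs
    back b∈ with a , a∈ , Rab ← surj b∈
            with b′ , b′∈ , Rab′ ← →cs a∈
            = ≡.subst (_∈ cs) (fun (proj₁ (cs→ b′∈)) b∈ Rab′ Rab) b′∈

-- Ordered field arithmetic and infinite sums attained by finite ones

module RealFieldProperties (R : RealField) where
  open RealField R
  open SetoidReasoning setoid
  open import Algebra.Properties.Ring ring using (-‿involutive; -‿distribʳ-*; -1*x≈-x)
  private module ≤ = IsTotalOrder isTotalOrder

  private module ∑ = BigOp +-commutativeMonoid

  ≤-resp : ∀ {x y z w} → x ≈ y → z ≈ w → x ≤ z → y ≤ w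
  ≤-resp x≈y z≈w x≤z = ≤.trans (≤.reflexive (sym x≈y)) (≤.trans x≤z (≤.reflexive z≈w))

  +-mono-≤ : ∀ {x y z w} → x ≤ y → z ≤ w → x + z ≤ y + w
  +-mono-≤ {x} {y} {z} {w} x≤y z≤w =
    ≤.trans (+-monoˡ-≤ z x≤y) (≤-resp (+-comm z y) (+-comm w y) (+-monoˡ-≤ y z≤w))

  +-nonNeg : ∀ {x y} → 0# ≤ x → 0# ≤ y → 0# ≤ x + y
  +-nonNeg 0≤x 0≤y = ≤-resp (+-identityˡ 0#) refl (+-mono-≤ 0≤x 0≤y)

  -‿nonNeg : ∀ {x} → x ≤ 0# → 0# ≤ - x
  -‿nonNeg {x} x≤0 = ≤-resp (-‿inverseʳ x) (+-identityˡ (- x)) (+-monoˡ-≤ (- x) x≤0)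

  -- Otherwise -1 is nonnegative, and 1 is its square.
  0≤1 : 0# ≤ 1#
  0≤1 with ≤.total 0# 1#
  ... | inj₁ 0≤1 = 0≤1
  ... | inj₂ 1≤0 = ≤-resp refl (trans (-1*x≈-x (- 1#)) (-‿involutive 1#))
                              (*-nonNeg (-‿nonNeg 1≤0) (-‿nonNeg 1≤0))

  ^-nonNeg : ∀ {x} n → 0# ≤ x → 0# ≤ x ^ n
  ^-nonNeg zero    0≤x = 0≤1
  ^-nonNeg (suc n) 0≤x = *-nonNeg 0≤x (^-nonNeg n 0≤x)

  ∑-nonNeg : ∀ {A : Set} (as : List A) {f} → (∀ a → a ∈ as → 0# ≤ f a) → 0# ≤ ∑-list as f
  ∑-nonNeg []       0≤f = ≤.refl
  ∑-nonNeg (a ∷ as) 0≤f = +-nonNeg (0≤f a (here ≡.refl)) (∑-nonNeg as (λ b → 0≤f b ∘ there))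

  ∏-nonNeg : ∀ {A : Set} (as : List A) {f} → (∀ a → a ∈ as → 0# ≤ f a) → 0# ≤ ∏-list as f
  ∏-nonNeg []       0≤f = 0≤1
  ∏-nonNeg (a ∷ as) 0≤f = *-nonNeg (0≤f a (here ≡.refl)) (∏-nonNeg as (λ b → 0≤f b ∘ there))

  *-cancel-0 : ∀ {x y} → ¬ x ≈ 0# → x * y ≈ 0# → y ≈ 0#
  *-cancel-0 {x} {y} x≉0 xy≈0 = begin
    y               ≈⟨ *-identityˡ y ⟨
    1# * y          ≈⟨ *-congʳ (⁻¹-inverseʳ x≉0) ⟨
    (x * x ⁻¹) * y  ≈⟨ *-congʳ (*-comm x (x ⁻¹)) ⟩
    (x ⁻¹ * x) * y  ≈⟨ *-assoc _ _ _ ⟩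
    x ⁻¹ * (x * y)  ≈⟨ *-congˡ xy≈0 ⟩
    x ⁻¹ * 0#       ≈⟨ zeroʳ _ ⟩
    0#              ∎

  *-positive : ∀ {x y} → 0# < x → 0# < y → 0# < x * y
  *-positive (0≤x , 0≉x) (0≤y , 0≉y) =
    *-nonNeg 0≤x 0≤y , λ 0≈xy → 0≉y (sym (*-cancel-0 (0≉x ∘ sym) (sym 0≈xy)))

  ∏-positive : ∀ {A : Set} (as : List A) {f} → (∀ a → a ∈ as → 0# < f a) → 0# < ∏-list as f
  ∏-positive []       0<f = 0≤1 , 0≉1
  ∏-positive (a ∷ as) 0<f =
    *-positive (0<f a (here ≡.refl)) (∏-positive as (λ b → 0<f b ∘ there))

  -- If `x ⁻¹` were at most 0, then -1 = x · (-x⁻¹) would be nonnegative, which forces 0 = 1.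
  ⁻¹-nonNeg : ∀ {x} → 0# < x → 0# ≤ x ⁻¹
  ⁻¹-nonNeg {x} (0≤x , 0≉x) with ≤.total 0# (x ⁻¹)
  ... | inj₁ 0≤x⁻¹ = 0≤x⁻¹
  ... | inj₂ x⁻¹≤0 = ⊥-elim (0≉1 (≤.antisym 0≤1 1≤0))
    where
    0≤-1 : 0# ≤ - 1#
    0≤-1 = ≤-resp refl (trans (sym (-‿distribʳ-* x (x ⁻¹))) (-‿cong (⁻¹-inverseʳ (0≉x ∘ sym))))
                  (*-nonNeg 0≤x (-‿nonNeg x⁻¹≤0))
    1≤0 : 1# ≤ 0#
    1≤0 = ≤-resp (+-identityˡ 1#) (-‿inverseˡ 1#) (+-monoˡ-≤ 1# 0≤-1)

  -- A maximum shows at once that `P` is inhabited and bounded, the conditions under which `⨆` is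
  -- specified.
  ⨆-maximum : ∀ P {x} → P x → IsUpperBound P x → ⨆ P ≈ x
  ⨆-maximum P {x} Px x-ub =
    let ub , least = ⨆-isSupremum P (x , Px) (x , x-ub) in ≤.antisym (least x-ub) (ub Px)

  module _ (I : Setoid 0ℓ 0ℓ) (P : Pred (Setoid.Carrier I) 0ℓ) (f : Setoid.Carrier I → Carrier)
           {A : Set} (code : Setoid.Carrier I → A) (g : A → Carrier) where
    private module I = Setoid I
    open UniqueSetoid I using () renaming (Unique to Uniqueᴵ)

    private
      -- Each index uses up its own code: `code i` is deleted from `as` before the induction
      -- continues, and injectivity keeps the codes of the later indices in the remaining list.
      -- Indices with `f i ≈ 0#` are skipped, and codes left over at the end only increase the right
      -- side.
      bound : (∀ {i j} → P i → P j → code i ≡ code j → i I.≈ j) →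
              (∀ {i} → P i → f i ≈ g (code i)) →
              ∀ is → Uniqueᴵ is → All P is → ∀ as →
              (∀ {a} → a ∈ as → 0# ≤ g a) →
              All (λ i → code i ∈ as ⊎ f i ≈ 0#) is →
              ∑-list is f ≤ ∑-list as g
      bound inj f≈g []       _          _          as 0≤g _ = ∑-nonNeg as (λ a → 0≤g)
      bound inj f≈g (i ∷ is) (_ ∷ is!)  (_ ∷ Pis)  as 0≤g (inj₂ fi≈0 ∷ ins) =
        ≤-resp (trans (sym (+-identityˡ _)) (+-congʳ (sym fi≈0))) refl
               (bound inj f≈g is is! Pis as 0≤g ins)
      bound inj f≈g (i ∷ is) (i∉ ∷ is!) (Pi ∷ Pis) as 0≤g (inj₁ i∈ ∷ ins)
        with ys , zs , ≡.refl ← ∈-∃++ i∈ =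
        ≤-resp refl (sym (∑.big-↭ g (shift (code i) ys zs)))
          (+-mono-≤ (≤.reflexive (f≈g Pi))
            (bound inj f≈g is is! Pis (ys ++ zs) (0≤g ∘ wider)
              (All.map drop (All.zip (All.zip (i∉ , Pis) , ins)))))
        where
        wider : ∀ {a} → a ∈ ys ++ zs → a ∈ ys ++ code i ∷ zs
        wider a∈ with ∈-++⁻ ys a∈
        ... | inj₁ a∈ys = ∈-++⁺ˡ a∈ys
        ... | inj₂ a∈zs = ∈-++⁺ʳ ys (there a∈zs)
        drop : ∀ {j} → ((¬ i I.≈ j) × P j) × (code j ∈ ys ++ code i ∷ zs ⊎ f j ≈ 0#) →
               code j ∈ ys ++ zs ⊎ f j ≈ 0#
        drop (_ , inj₂ fj≈0) = inj₂ fj≈0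
        drop ((i≉j , Pj) , inj₁ j∈) with ∈-++⁻ ys j∈
        ... | inj₁ j∈ys            = inj₁ (∈-++⁺ˡ j∈ys)
        ... | inj₂ (here cj≡ci)    = ⊥-elim (i≉j (inj Pi Pj (≡.sym cj≡ci)))
        ... | inj₂ (there j∈zs)    = inj₁ (∈-++⁺ʳ ys j∈zs)

      -- Preimages of the codes make the sum over `as` itself one of the finite subsums; they are
      -- distinct because equivalent indices have equal codes.
      choose : (∀ {i j} → i I.≈ j → code i ≡ code j) →
               (∀ {i} → P i → f i ≈ g (code i)) →
               ∀ as → Unique as → (∀ {a} → a ∈ as → ∃[ i ] (P i × code i ≡ a)) →
               ∃[ is ] (Uniqueᴵ is × All P is × All (λ i → code i ∈ as) is ×
                        ∑-list is f ≈ ∑-list as g)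
      choose code-cong f≈g []       _          _    = [] , [] , [] , [] , refl
      choose code-cong f≈g (a ∷ as) (a∉ ∷ as!) surj
        with i , Pi , ≡.refl ← surj (here ≡.refl)
        with is , is! , Pis , is∈ , eq ← choose code-cong f≈g as as! (surj ∘ there)
        = i ∷ is , All.map (λ j∈ i≈j → All.lookup a∉ j∈ (code-cong i≈j)) is∈ ∷ is!
        , Pi ∷ Pis , here ≡.refl ∷ All.map there is∈ , +-cong (f≈g Pi) eq

    ∑⁺-enumerate : ∀ as → Unique as →
      (∀ {i j} → i I.≈ j → code i ≡ code j) →
      (∀ {i j} → P i → P j → code i ≡ code j → i I.≈ j) →
      (∀ {i} → P i → 0# ≤ f i) →
      (∀ {i} → P i → f i ≈ g (code i)) →
      (∀ {i} → P i → code i ∈ as ⊎ f i ≈ 0#) →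
      (∀ {a} → a ∈ as → ∃[ i ] (P i × code i ≡ a)) →
      ∑⁺ I P f ≈ ∑-list as g
    ∑⁺-enumerate as as! code-cong inj 0≤f f≈g tot surj =
      let is , is! , Pis , _ , eq = choose code-cong f≈g as as! surj in
      ⨆-maximum (FiniteSubsum I P f) (is , is! , Pis , sym eq)
        (λ { (js , js! , Pjs , x≈) → ≤-resp (sym x≈) refl
               (bound inj f≈g js js! Pjs as 0≤g (All.map tot Pjs)) })
      where
      0≤g : ∀ {a} → a ∈ as → 0# ≤ g a
      0≤g a∈ with i , Pi , ≡.refl ← surj a∈ = ≤-resp refl (f≈g Pi) (0≤f Pi)

-- Partitions

nth-beyond : ∀ ks {i} → length ks ℕ.≤ i → nth ks i ≡ 0
nth-beyond []       _                   = ≡.refl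
nth-beyond (k ∷ ks) {suc i} (s≤s len≤i) = nth-beyond ks len≤i

nth-positive : ∀ {ks} → All (0 ℕ.<_) ks → ∀ {i} → i ℕ.< length ks → 0 ℕ.< nth ks i
nth-positive (0<k ∷ 0<ks) {zero}  _           = 0<k
nth-positive (0<k ∷ 0<ks) {suc i} (s≤s i<len) = nth-positive 0<ks i<len

nth-step : ∀ {ks} → Linked ℕ._≥_ ks → ∀ i → nth ks (suc i) ℕ.≤ nth ks i
nth-step []          i       = z≤n
nth-step [-]         i       = z≤n
nth-step (k≥l ∷ l)   zero    = k≥l
nth-step (k≥l ∷ l)   (suc i) = nth-step l i

-- Positivity excludes trailing zeros, so the zero-padded rows also determine the length.
nth-ext : ∀ {ks ls} → All (0 ℕ.<_) ks → All (0 ℕ.<_) ls → (∀ i → nth ks i ≡ nth ls i) → ks ≡ ls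
nth-ext []        []        eq = ≡.refl
nth-ext []        (0<l ∷ _) eq = ⊥-elim (ℕₚ.<⇒≢ 0<l (eq 0))
nth-ext (0<k ∷ _) []        eq = ⊥-elim (ℕₚ.<⇒≢ 0<k (≡.sym (eq 0)))
nth-ext (_ ∷ ks)  (_ ∷ ls)  eq = ≡.cong₂ _∷_ (eq 0) (nth-ext ks ls (eq ∘ suc))

parts-injective : ∀ {κ μ} → parts κ ≡ parts μ → κ ≡ μ
parts-injective {mkPartition ks s p} {mkPartition .ks s′ p′} ≡.refl =
  ≡.cong₂ (mkPartition ks) (Linked.irrelevant ℕₚ.≤-irrelevant s s′)
                           (All.irrelevant ℕₚ.≤-irrelevant p p′)

part-injective : ∀ {κ μ} → (∀ i → part κ i ≡ part μ i) → κ ≡ μ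
part-injective {κ} {μ} eq = parts-injective (nth-ext (positive κ) (positive μ) eq)

infix 4 _≟ₚ_
_≟ₚ_ : DecidableEquality Partition
κ ≟ₚ μ = map′ parts-injective (≡.cong parts) (Listₚ.≡-dec ℕ._≟_ (parts κ) (parts μ))

part-antitone : ∀ κ {i j} → i ℕ.≤ j → part κ j ℕ.≤ part κ i
part-antitone κ i≤j = go (ℕₚ.≤⇒≤′ i≤j)
  where
  go : ∀ {i j} → i ℕ.≤′ j → part κ j ℕ.≤ part κ i
  go (ℕ.≤′-reflexive ≡.refl) = ℕₚ.≤-refl
  go (ℕ.≤′-step i≤j)         = ℕₚ.≤-trans (nth-step (sorted κ) _) (go i≤j)

part-support : ∀ κ {i} → 0 ℕ.< part κ i → i ℕ.< length (parts κ)
part-support κ {i} 0<part with i ℕ.<? length (parts κ)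
... | yes i<len = i<len
... | no  i≮len = ⊥-elim (ℕₚ.<⇒≢ 0<part (≡.sym (nth-beyond (parts κ) (ℕₚ.≮⇒≥ i≮len))))

infix 4 _⊑_
-- Containment over all rows, equivalent to `_⊆_` but composable without attention to lengths.
_⊑_ : Partition → Partition → Set
μ ⊑ κ = ∀ i → part μ i ℕ.≤ part κ i

⊆⇒⊑ : ∀ {μ κ} → μ ⊆ κ → μ ⊑ κ
⊆⇒⊑ {μ} {κ} μ⊆κ i with i ℕ.<? length (parts μ)
... | yes i<len = All.lookup μ⊆κ (∈-upTo⁺ i<len)
... | no  i≮len = ≡.subst (ℕ._≤ part κ i) (≡.sym (nth-beyond (parts μ) (ℕₚ.≮⇒≥ i≮len))) z≤n

⊑⇒⊆ : ∀ {μ κ} → μ ⊑ κ → μ ⊆ κ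
⊑⇒⊆ μ⊑κ = All.tabulate (λ {i} _ → μ⊑κ i)

≻⇒⊒ : ∀ {κ μ} → κ ≻ μ → μ ⊑ κ
≻⇒⊒ κ≻μ i = proj₁ (κ≻μ i)

⊑-length : ∀ {μ κ} → μ ⊑ κ → length (parts μ) ℕ.≤ length (parts κ)
⊑-length {μ} {κ} μ⊑κ with length (parts μ) in eq
... | zero  = z≤n
... | suc n = part-support κ
  (ℕₚ.<-≤-trans (nth-positive (positive μ) (≡.subst (n ℕ.<_) (≡.sym eq) ℕₚ.≤-refl)) (μ⊑κ n))

infix 4 _≻?_
-- Beyond both lengths all rows are zero, so finitely many rows decide.
_≻?_ : ∀ κ μ → Dec (κ ≻ μ)
κ ≻? μ = map′ to from (All.all? row? (upTo (length (parts κ) ℕ.⊔ length (parts μ))))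
  where
  row? = λ i → (part κ i ℕ.≥? part μ i) ×-dec (part μ i ℕ.≥? part κ (suc i))
  to : All (λ i → (part κ i ℕ.≥ part μ i) × (part μ i ℕ.≥ part κ (suc i)))
           (upTo (length (parts κ) ℕ.⊔ length (parts μ))) → κ ≻ μ
  to rows i with i ℕ.<? length (parts κ) ℕ.⊔ length (parts μ)
  ... | yes i< = All.lookup rows (∈-upTo⁺ i<)
  ... | no  i≮ =
    let κ≤i = ℕₚ.m⊔n≤o⇒m≤o _ _ (ℕₚ.≮⇒≥ i≮)
        μ≤i = ℕₚ.m⊔n≤o⇒n≤o (length (parts κ)) _ (ℕₚ.≮⇒≥ i≮)
    in ≡.subst (ℕ._≤ part κ i) (≡.sym (nth-beyond (parts μ) μ≤i)) z≤n
     , ≡.subst (ℕ._≤ part μ i) (≡.sym (nth-beyond (parts κ) (ℕₚ.m≤n⇒m≤1+n κ≤i))) z≤n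
  from : κ ≻ μ → _
  from κ≻μ = All.tabulate (λ {i} _ → κ≻μ i)

module FromRows where
  rows : (ℕ → ℕ) → ℕ → List ℕ
  rows f zero    = []
  rows f (suc L) with f 0
  ... | zero  = []
  ... | suc k = suc k ∷ rows (f ∘ suc) L

  -- Stopping at the first zero loses nothing: an antitone `f` stays zero from there on.
  nth-rows : ∀ f L → (∀ i → f (suc i) ℕ.≤ f i) → (∀ i → L ℕ.≤ i → f i ≡ 0) →
             ∀ i → nth (rows f L) i ≡ f i
  nth-rows f zero    anti van i = ≡.sym (van i z≤n)
  nth-rows f (suc L) anti van i with f 0 in eq
  nth-rows f (suc L) anti van i       | zero  = ≡.sym (vanish i)
    where
    vanish : ∀ i → f i ≡ 0
    vanish zero    = eq
    vanish (suc i) = ℕₚ.n≤0⇒n≡0 (≡.subst (f (suc i) ℕ.≤_) (vanish i) (anti i))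
  nth-rows f (suc L) anti van zero    | suc k = ≡.sym eq
  nth-rows f (suc L) anti van (suc i) | suc k =
    nth-rows (f ∘ suc) L (anti ∘ suc) (λ i → van (suc i) ∘ s≤s) i

  rows-positive : ∀ f L → All (0 ℕ.<_) (rows f L)
  rows-positive f zero    = []
  rows-positive f (suc L) with f 0
  ... | zero  = []
  ... | suc k = s≤s z≤n ∷ rows-positive (f ∘ suc) L

  ∷-linked : ∀ {k ks} → nth ks 0 ℕ.≤ k → Linked ℕ._≥_ ks → Linked ℕ._≥_ (k ∷ ks)
  ∷-linked {ks = []}    _    _ = [-]
  ∷-linked {ks = _ ∷ _} l≤k  l = l≤k ∷ l

  rows-sorted : ∀ f L → (∀ i → f (suc i) ℕ.≤ f i) → (∀ i → L ℕ.≤ i → f i ≡ 0) →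
                Linked ℕ._≥_ (rows f L)
  rows-sorted f zero    anti van = []
  rows-sorted f (suc L) anti van with f 0 in eq
  ... | zero  = []
  ... | suc k = ∷-linked
    (ℕₚ.≤-trans (ℕₚ.≤-reflexive (nth-rows (f ∘ suc) L (anti ∘ suc) (λ i → van (suc i) ∘ s≤s) 0))
                (≡.subst (f 1 ℕ.≤_) eq (anti 0)))
    (rows-sorted (f ∘ suc) L (anti ∘ suc) (λ i → van (suc i) ∘ s≤s))

fromRows : ∀ f L → (∀ i → f (suc i) ℕ.≤ f i) → (∀ i → L ℕ.≤ i → f i ≡ 0) →
           ∃[ κ ] (∀ i → part κ i ≡ f i)
fromRows f L anti van =
  mkPartition (rows f L) (rows-sorted f L anti van) (rows-positive f L)
  , nth-rows f L anti van
  where open FromRows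

-- Finite order ideals and sizes of partitions

module Box (a b : ℕ) where

  -- Lists that are not partitions default to `∅`; the repetitions this causes are removed in `box`.
  toPartition : List ℕ → Partition
  toPartition ks with Linked.linked? ℕ._≥?_ ks | All.all? (0 ℕ.<?_) ks
  ... | yes s | yes p = mkPartition ks s p
  ... | _     | _     = ∅

  toPartition-parts : ∀ κ → toPartition (parts κ) ≡ κ
  toPartition-parts κ with Linked.linked? ℕ._≥?_ (parts κ) | All.all? (0 ℕ.<?_) (parts κ)
  ... | yes s | yes p = parts-injective ≡.refl
  ... | yes s | no ¬p = ⊥-elim (¬p (positive κ))
  ... | no ¬s | _     = ⊥-elim (¬s (sorted κ))

  lists : ℕ → List (List ℕ)
  lists zero    = [] ∷ []
  lists (suc l) = [] ∷ cartesianProductWith _∷_ (upTo (suc b)) (lists l)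

  ∈-lists : ∀ l ks → length ks ℕ.≤ l → All (ℕ._≤ b) ks → ks ∈ lists l
  ∈-lists zero    []       _           _            = here ≡.refl
  ∈-lists (suc l) []       _           _            = here ≡.refl
  ∈-lists (suc l) (k ∷ ks) (s≤s len≤l) (k≤b ∷ ks≤b) =
    there (∈-cartesianProductWith⁺ _∷_ (∈-upTo⁺ (s≤s k≤b)) (∈-lists l ks len≤l ks≤b))

  Fits : Partition → Set
  Fits κ = length (parts κ) ℕ.≤ a × part κ 0 ℕ.≤ b

  fits? : ∀ κ → Dec (Fits κ)
  fits? κ = (length (parts κ) ℕ.≤? a) ×-dec (part κ 0 ℕ.≤? b)

  box : List Partition
  box = deduplicate _≟ₚ_ (filter fits? (map toPartition (lists a)))

  box-unique : Unique box
  box-unique = UniqueDec.deduplicate-! _≟ₚ_ _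

  ≤-head : ∀ {c ks} → Linked ℕ._≥_ ks → nth ks 0 ℕ.≤ c → All (ℕ._≤ c) ks
  ≤-head []       k≤c = []
  ≤-head [-]      k≤c = k≤c ∷ []
  ≤-head (r ∷ l)  k≤c = k≤c ∷ ≤-head l (ℕₚ.≤-trans r k≤c)

  ∈-box⁺ : ∀ {κ} → Fits κ → κ ∈ box
  ∈-box⁺ {κ} fits@(len≤a , κ₀≤b) = ∈-deduplicate⁺ _≟ₚ_ (∈-filter⁺ fits?
    (≡.subst (_∈ map toPartition (lists a)) (toPartition-parts κ)
      (∈-map⁺ toPartition (∈-lists a (parts κ) len≤a (≤-head (sorted κ) κ₀≤b)))) fits)

  ∈-box⁻ : ∀ {κ} → κ ∈ box → Fits κ
  ∈-box⁻ κ∈ = proj₂ (∈-filter⁻ fits? {xs = map toPartition (lists a)}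
    (∈-deduplicate⁻ _≟ₚ_ (filter fits? (map toPartition (lists a))) κ∈))

  box-closed : ∀ {κ μ} → κ ∈ box → μ ⊑ κ → μ ∈ box
  box-closed {κ} {μ} κ∈ μ⊑κ = let len≤a , κ₀≤b = ∈-box⁻ κ∈ in
    ∈-box⁺ (ℕₚ.≤-trans (⊑-length {μ} {κ} μ⊑κ) len≤a , ℕₚ.≤-trans (μ⊑κ 0) κ₀≤b)

-- The partitions inside a rectangle form an order ideal. Taking the sum of the lengths as height
-- and the sum of the first rows as width makes room for every `Λ i`.
finite-ideal : ∀ {I : Set} (is : List I) (Λ : I → Partition) →
  ∃[ B ] (Unique B × (∀ {κ μ} → κ ∈ B → μ ⊑ κ → μ ∈ B) × (∀ {i} → i ∈ is → Λ i ∈ B))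
finite-ideal is Λ = box , box-unique , box-closed , λ i∈ →
  ∈-box⁺ (member-≤ (length ∘ parts ∘ Λ) i∈ , member-≤ (λ i → part (Λ i) 0) i∈)
  where
  open Box (sum (map (length ∘ parts ∘ Λ) is)) (sum (map (λ i → part (Λ i) 0) is))
  member-≤ : ∀ f {i js} → i ∈ js → f i ℕ.≤ sum (map f js)
  member-≤ f (here ≡.refl) = ℕₚ.m≤m+n _ _
  member-≤ f (there i∈)    = ℕₚ.≤-trans (member-≤ f i∈) (ℕₚ.m≤n+m _ _)

nth-sum : ∀ ks L → length ks ℕ.≤ L → sum (map (nth ks) (upTo L)) ≡ sum ks
nth-sum [] L _ = zeros (upTo L)
  where
  zeros : ∀ is → sum (map (nth []) is) ≡ 0
  zeros []       = ≡.refl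
  zeros (i ∷ is) = zeros is
nth-sum (k ∷ ks) (suc L) (s≤s len≤L) = ≡.cong (k ℕ.+_) (≡.trans
  (≡.cong sum (≡.trans (Listₚ.map-applyUpTo suc (nth (k ∷ ks)) L)
                       (≡.sym (Listₚ.map-applyUpTo id (nth ks) L))))
  (nth-sum ks L len≤L))

size-mono : ∀ {μ κ} → μ ⊑ κ → size μ ℕ.≤ size κ
size-mono {μ} {κ} μ⊑κ = ≡.subst₂ ℕ._≤_
  (nth-sum (parts μ) L (⊑-length {μ} {κ} μ⊑κ)) (nth-sum (parts κ) L ℕₚ.≤-refl) (go (upTo L))
  where
  L = length (parts κ)
  go : ∀ is → sum (map (part μ) is) ℕ.≤ sum (map (part κ) is)
  go []       = z≤n
  go (i ∷ is) = ℕₚ.+-mono-≤ (μ⊑κ i) (go is)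

size-∸ : ∀ {ν μ L} → μ ⊑ ν → length (parts ν) ℕ.≤ L →
         sum (map (λ i → part ν i ℕ.∸ part μ i) (upTo L)) ≡ size ν ℕ.∸ size μ
size-∸ {ν} {μ} {L} μ⊑ν len≤L = ≡.trans (≡.sym (ℕₚ.m+n∸n≡m _ (sum (map (part μ) (upTo L)))))
  (≡.cong₂ ℕ._∸_ (≡.trans (go (upTo L)) (nth-sum (parts ν) L len≤L))
    (nth-sum (parts μ) L (ℕₚ.≤-trans (⊑-length {μ} {ν} μ⊑ν) len≤L)))
  where
  go : ∀ is → sum (map (λ i → part ν i ℕ.∸ part μ i) is) ℕ.+ sum (map (part μ) is) ≡
              sum (map (part ν) is)
  go []       = ≡.refl
  go (i ∷ is) = ≡.trans
    (interchange (part ν i ℕ.∸ part μ i) _ (part μ i) _)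
    (≡.cong₂ ℕ._+_ (ℕₚ.m∸n+n≡m (μ⊑ν i)) (go is))
    where open import Algebra.Properties.CommutativeSemigroup ℕₚ.+-commutativeSemigroup using (interchange)

-- Transfer matrices

module _ {A B C : Set} (f : A → B → C) (h : A → List B) where

  ∈-concatMap-map⁺ : ∀ {as a b} → a ∈ as → b ∈ h a → f a b ∈ concatMap (λ a → map (f a) (h a)) as
  ∈-concatMap-map⁺ (here ≡.refl) b∈ = ∈-++⁺ˡ (∈-map⁺ (f _) b∈)
  ∈-concatMap-map⁺ {a′ ∷ _} (there a∈) b∈ = ∈-++⁺ʳ (map (f a′) (h a′)) (∈-concatMap-map⁺ a∈ b∈)

  ∈-concatMap-map⁻ : ∀ as {c} → c ∈ concatMap (λ a → map (f a) (h a)) as →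
                     ∃[ a ] ∃[ b ] (a ∈ as × b ∈ h a × c ≡ f a b)
  ∈-concatMap-map⁻ (a ∷ as) c∈ with ∈-++⁻ (map (f a) (h a)) c∈
  ... | inj₁ c∈ˡ = let b , b∈ , eq = ∈-map⁻ (f a) c∈ˡ in a , b , here ≡.refl , b∈ , eq
  ... | inj₂ c∈ʳ = let a′ , b , a′∈ , b∈ , eq = ∈-concatMap-map⁻ as c∈ʳ in
                   a′ , b , there a′∈ , b∈ , eq

  concatMap-map-unique : (∀ {a a′ b b′} → f a b ≡ f a′ b′ → a ≡ a′ × b ≡ b′) →
                         (∀ a → Unique (h a)) → ∀ {as} → Unique as →
                         Unique (concatMap (λ a → map (f a) (h a)) as)
  concatMap-map-unique inj h! []                        = []
  concatMap-map-unique inj h! {a ∷ as} (a∉ ∷ as!) =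
    Uniqueₚ.++⁺ (Uniqueₚ.map⁺ (proj₂ ∘ inj) (h! a)) (concatMap-map-unique inj h! as!)
      (λ (c∈ˡ , c∈ʳ) → let _ , _ , c≡ = ∈-map⁻ (f a) c∈ˡ
                           _ , _ , a′∈ , _ , c≡′ = ∈-concatMap-map⁻ as c∈ʳ
                       in All.lookup a∉ a′∈ (proj₁ (inj (≡.trans (≡.sym c≡) c≡′))))

module _ (R : RealField) where
  open RealField R
  open BigOp +-commutativeMonoid using (_when_)

  *-∑ : ∀ {A : Set} x (as : List A) f → x * ∑-list as f ≈ ∑-list as (λ a → x * f a)
  *-∑ x []       f = zeroʳ x
  *-∑ x (a ∷ as) f = trans (distribˡ x _ _) (+-congˡ (*-∑ x as f))

  ∑-* : ∀ {A : Set} (as : List A) f x → ∑-list as f * x ≈ ∑-list as (λ a → f a * x)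
  ∑-* []       f x = zeroˡ x
  ∑-* (a ∷ as) f x = trans (distribʳ x _ _) (+-congˡ (∑-* as f x))

  when-* : ∀ {P : Set} x y (d : Dec P) → (x when d) * y ≈ (x * y) when d
  when-* x y (yes _) = refl
  when-* x y (no _)  = zeroˡ y

module TransferMatrix (R : RealField) {B : List Partition} (B! : Unique B) where
  open RealField R
  open SetoidReasoning setoid
  private
    module ∑ = BigOp +-commutativeMonoid
    module ∏ = BigOp *-commutativeMonoid
  open ∑ using (_when_)

  Kernel : Set
  Kernel = Partition → Partition → Carrier

  δ : Kernel
  δ κ μ = 1# when (κ ≟ₚ μ)

  δ-sym : ∀ κ μ → δ κ μ ≈ δ μ κ
  δ-sym κ μ = ∑.when-cong (κ ≟ₚ μ) (μ ≟ₚ κ) ≡.sym ≡.sym (λ _ → refl)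

  ∑-δˡ : ∀ {κ} (f : Partition → Carrier) → κ ∈ B → ∑-list B (λ μ → δ κ μ * f μ) ≈ f κ
  ∑-δˡ {κ} f κ∈ = trans
    (∑.big-single κ B! κ∈ (λ μ μ≢κ → trans (*-congʳ (∑.when-no (κ ≟ₚ μ) (μ≢κ ∘ ≡.sym))) (zeroˡ _)))
    (trans (*-congʳ (∑.when-yes (κ ≟ₚ κ) ≡.refl)) (*-identityˡ _))

  -- An entry of the matrix product of the kernels, with intermediate indices in `B`. The endpoints
  -- may be arbitrary partitions, hence the membership hypotheses wherever a factor `δ` is inserted
  -- or absorbed.
  pathSum : List Kernel → Kernel
  pathSum []       κ μ = δ κ μ
  pathSum (k ∷ ks) κ μ = ∑-list B (λ ν → k κ ν * pathSum ks ν μ)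

  pathSum-cong : ∀ {L : Set} (ls : List L) {k k′ : L → Kernel} →
    (∀ {l} → l ∈ ls → ∀ κ μ → k l κ μ ≈ k′ l κ μ) →
    ∀ κ μ → pathSum (map k ls) κ μ ≈ pathSum (map k′ ls) κ μ
  pathSum-cong []       k≈k′ κ μ = refl
  pathSum-cong (l ∷ ls) k≈k′ κ μ = ∑.big-cong B λ ν _ →
    *-cong (k≈k′ (here ≡.refl) κ ν) (pathSum-cong ls (k≈k′ ∘ there) ν μ)

  pathSum-++ : ∀ ks {ls κ μ} → κ ∈ B →
    pathSum (ks ++ ls) κ μ ≈ ∑-list B (λ ν → pathSum ks κ ν * pathSum ls ν μ)
  pathSum-++ []       {ls} {κ} {μ} κ∈ = sym (∑-δˡ (λ ν → pathSum ls ν μ) κ∈)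
  pathSum-++ (k ∷ ks) {ls} {κ} {μ} κ∈ = begin
    ∑-list B (λ ρ → k κ ρ * pathSum (ks ++ ls) ρ μ)
      ≈⟨ ∑.big-cong B (λ ρ ρ∈ → *-congˡ (pathSum-++ ks ρ∈)) ⟩
    ∑-list B (λ ρ → k κ ρ * ∑-list B (λ ν → pathSum ks ρ ν * pathSum ls ν μ))
      ≈⟨ ∑.big-cong B (λ ρ _ → *-∑ R (k κ ρ) B _) ⟩
    ∑-list B (λ ρ → ∑-list B (λ ν → k κ ρ * (pathSum ks ρ ν * pathSum ls ν μ)))
      ≈⟨ ∑.big-swap B B _ ⟩
    ∑-list B (λ ν → ∑-list B (λ ρ → k κ ρ * (pathSum ks ρ ν * pathSum ls ν μ)))
      ≈⟨ ∑.big-cong B (λ ν _ → ∑.big-cong B (λ ρ _ → *-assoc _ _ _)) ⟨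
    ∑-list B (λ ν → ∑-list B (λ ρ → (k κ ρ * pathSum ks ρ ν) * pathSum ls ν μ))
      ≈⟨ ∑.big-cong B (λ ν _ → ∑-* R B (λ ρ → k κ ρ * pathSum ks ρ ν) (pathSum ls ν μ)) ⟨
    ∑-list B (λ ν → pathSum (k ∷ ks) κ ν * pathSum ls ν μ)  ∎

  pathSum-[-] : ∀ k {κ μ} → μ ∈ B → pathSum [ k ] κ μ ≈ k κ μ
  pathSum-[-] k {κ} {μ} μ∈ = trans
    (∑.big-cong B (λ ν _ → trans (*-comm _ _) (*-congʳ (δ-sym ν μ)))) (∑-δˡ (k κ) μ∈)

  -- Transposing a matrix product reverses its factors.
  pathSum-reverse : ∀ {L : Set} (k : L → Kernel) ls {κ μ} → κ ∈ B → μ ∈ B →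
    pathSum (map k (reverse ls)) κ μ ≈ pathSum (map (flip ∘ k) ls) μ κ
  pathSum-reverse k []       {κ} {μ} κ∈ μ∈ = δ-sym κ μ
  pathSum-reverse k (l ∷ ls) {κ} {μ} κ∈ μ∈ = begin
    pathSum (map k (reverse (l ∷ ls))) κ μ
      ≡⟨ ≡.cong (λ js → pathSum js κ μ)
           (≡.trans (≡.cong (map k) (Listₚ.unfold-reverse l ls)) (Listₚ.map-++ k (reverse ls) [ l ])) ⟩
    pathSum (map k (reverse ls) ++ [ k l ]) κ μ
      ≈⟨ pathSum-++ (map k (reverse ls)) κ∈ ⟩
    ∑-list B (λ ν → pathSum (map k (reverse ls)) κ ν * pathSum [ k l ] ν μ)
      ≈⟨ ∑.big-cong B (λ ν ν∈ → trans
           (*-cong (pathSum-reverse k ls κ∈ ν∈) (pathSum-[-] (k l) μ∈)) (*-comm _ _)) ⟩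
    ∑-list B (λ ν → k l ν μ * pathSum (map (flip ∘ k) ls) ν κ)  ∎

  -- Each block is a column `f i` times a row `g i`. In the product, every inner row meets the next
  -- column and gives a scalar; only the outermost column and row keep their argument.
  pathSum-rank-one : ∀ {L : Set} {n} (k : L → Kernel) (ls : Fin (suc n) → List L)
    (f g : Fin (suc n) → Partition → Carrier) →
    (∀ i {κ μ} → κ ∈ B → μ ∈ B → pathSum (map k (ls i)) κ μ ≈ f i κ * g i μ) →
    ∀ {κ μ} → κ ∈ B → μ ∈ B →
    pathSum (map k (concat (tabulate ls))) κ μ ≈
    f Fin.zero κ * (∏-list (allFin n) (λ i → ∑-list B (λ ν → g (inject₁ i) ν * f (Fin.suc i) ν))
                    * g (fromℕ n) μ)
  pathSum-rank-one {n = zero} k ls f g rank-one {κ} {μ} κ∈ μ∈ = begin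
    pathSum (map k (ls Fin.zero ++ [])) κ μ
      ≡⟨ ≡.cong (λ l → pathSum (map k l) κ μ) (Listₚ.++-identityʳ (ls Fin.zero)) ⟩
    pathSum (map k (ls Fin.zero)) κ μ
      ≈⟨ rank-one Fin.zero κ∈ μ∈ ⟩
    f Fin.zero κ * g Fin.zero μ
      ≈⟨ *-congˡ (*-identityˡ _) ⟨
    f Fin.zero κ * (1# * g Fin.zero μ)  ∎
  pathSum-rank-one {n = suc n} k ls f g rank-one {κ} {μ} κ∈ μ∈ = begin
    pathSum (map k (ls Fin.zero ++ concat (tabulate (ls ∘ Fin.suc)))) κ μ
      ≡⟨ ≡.cong (λ ks → pathSum ks κ μ) (Listₚ.map-++ k (ls Fin.zero) _) ⟩
    pathSum (map k (ls Fin.zero) ++ map k (concat (tabulate (ls ∘ Fin.suc)))) κ μ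
      ≈⟨ pathSum-++ (map k (ls Fin.zero)) κ∈ ⟩
    ∑-list B (λ ν → pathSum (map k (ls Fin.zero)) κ ν *
                    pathSum (map k (concat (tabulate (ls ∘ Fin.suc)))) ν μ)
      ≈⟨ ∑.big-cong B (λ ν ν∈ → trans
           (*-cong (rank-one Fin.zero κ∈ ν∈)
             (pathSum-rank-one k (ls ∘ Fin.suc) (f ∘ Fin.suc) (g ∘ Fin.suc) (rank-one ∘ Fin.suc) ν∈ μ∈))
           (trans (*-assoc _ _ _) (*-congˡ (sym (*-assoc _ _ _))))) ⟩
    ∑-list B (λ ν → f Fin.zero κ * ((g Fin.zero ν * f (Fin.suc Fin.zero) ν) * rest))
      ≈⟨ *-∑ R (f Fin.zero κ) B _ ⟨
    f Fin.zero κ * ∑-list B (λ ν → (g Fin.zero ν * f (Fin.suc Fin.zero) ν) * rest)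
      ≈⟨ *-congˡ (∑-* R B (λ ν → g Fin.zero ν * f (Fin.suc Fin.zero) ν) rest) ⟨
    f Fin.zero κ * (pairing Fin.zero * (∏-list (allFin n) (pairing ∘ Fin.suc) * g (fromℕ (suc n)) μ))
      ≈⟨ *-congˡ (*-assoc _ _ _) ⟨
    f Fin.zero κ * ((pairing Fin.zero * ∏-list (allFin n) (pairing ∘ Fin.suc)) * g (fromℕ (suc n)) μ)
      ≈⟨ *-congˡ (*-congʳ (*-congˡ (trans
           (reflexive (≡.cong (λ is → ∏-list is pairing) (≡.sym (Listₚ.map-tabulate id Fin.suc))))
           (∏.big-map Fin.suc (allFin n) pairing)))) ⟨
    f Fin.zero κ * (∏-list (allFin (suc n)) pairing * g (fromℕ (suc n)) μ)  ∎
    where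
    pairing : Fin (suc n) → Carrier
    pairing i = ∑-list B (λ ν → g (inject₁ i) ν * f (Fin.suc i) ν)
    rest = ∏-list (allFin n) (pairing ∘ Fin.suc) * g (fromℕ (suc n)) μ

  module Paths {L : Set} (rel : L → Partition → Partition → Set)
               (rel? : ∀ l κ μ → Dec (rel l κ μ)) (w : L → Kernel) where

    transfer : L → Kernel
    transfer l κ μ = w l κ μ when rel? l κ μ

    -- The list of vertices omits the starting one, so it has one entry per step, and only these
    -- entries are required to lie in `B`.
    data IsPath : List L → Partition → Partition → List Partition → Set where
      []  : ∀ {κ} → IsPath [] κ κ []
      _∷_ : ∀ {l ls κ ν μ νs} → rel l κ ν × ν ∈ B → IsPath ls ν μ νs →
            IsPath (l ∷ ls) κ μ (ν ∷ νs)

    paths : List L → Partition → Partition → List (List Partition)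
    paths []       κ μ with κ ≟ₚ μ
    ... | yes _ = [] ∷ []
    ... | no  _ = []
    paths (l ∷ ls) κ μ = concatMap (λ ν → map (ν ∷_) (paths ls ν μ)) (filter (rel? l κ) B)

    paths-unique : ∀ ls κ μ → Unique (paths ls κ μ)
    paths-unique []       κ μ with κ ≟ₚ μ
    ... | yes _ = [] ∷ []
    ... | no  _ = []
    paths-unique (l ∷ ls) κ μ = concatMap-map-unique _∷_ (λ ν → paths ls ν μ)
      Listₚ.∷-injective (λ ν → paths-unique ls ν μ) (Uniqueₚ.filter⁺ (rel? l κ) B!)

    ∈-paths⁺ : ∀ {ls κ μ νs} → IsPath ls κ μ νs → νs ∈ paths ls κ μ
    ∈-paths⁺ {κ = κ} [] with κ ≟ₚ κ
    ... | yes _   = here ≡.refl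
    ... | no  κ≢κ = ⊥-elim (κ≢κ ≡.refl)
    ∈-paths⁺ {l ∷ ls} {κ} {μ} ((r , ν∈) ∷ p) =
      ∈-concatMap-map⁺ _∷_ (λ ν → paths ls ν μ) (∈-filter⁺ (rel? l κ) ν∈ r) (∈-paths⁺ p)

    ∈-paths⁻ : ∀ ls {κ μ νs} → νs ∈ paths ls κ μ → IsPath ls κ μ νs
    ∈-paths⁻ []       {κ} {μ} νs∈ with κ ≟ₚ μ
    ∈-paths⁻ [] (here ≡.refl) | yes ≡.refl = []
    ∈-paths⁻ (l ∷ ls) {κ} {μ} νs∈
      with ν , νs′ , ν∈ , νs′∈ , ≡.refl ←
           ∈-concatMap-map⁻ _∷_ (λ ν → paths ls ν μ) (filter (rel? l κ) B) νs∈
      with ν∈B , r ← ∈-filter⁻ (rel? l κ) {xs = B} ν∈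
      = (r , ν∈B) ∷ ∈-paths⁻ ls νs′∈

    pathWeight : List L → Partition → List Partition → Carrier
    pathWeight (l ∷ ls) κ (ν ∷ νs) = w l κ ν * pathWeight ls ν νs
    pathWeight _        _ _        = 1#

    -- Expanding the matrix product gives one term per sequence of intermediate indices; the
    -- relation, folded into `transfer` as a zero entry, removes the sequences that are not paths.
    ∑-paths : ∀ ls κ μ →
      ∑-list (paths ls κ μ) (pathWeight ls κ) ≈ pathSum (map transfer ls) κ μ
    ∑-paths []       κ μ with κ ≟ₚ μ
    ... | yes κ≡μ = trans (+-identityʳ 1#) (sym (∑.when-yes (κ ≟ₚ μ) κ≡μ))
    ... | no  κ≢μ = sym (∑.when-no (κ ≟ₚ μ) κ≢μ)
    ∑-paths (l ∷ ls) κ μ = begin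
      ∑-list (paths (l ∷ ls) κ μ) (pathWeight (l ∷ ls) κ)
        ≈⟨ ∑.big-concatMap _ (filter (rel? l κ) B) _ ⟩
      ∑-list (filter (rel? l κ) B)
             (λ ν → ∑-list (map (ν ∷_) (paths ls ν μ)) (pathWeight (l ∷ ls) κ))
        ≈⟨ ∑.big-cong (filter (rel? l κ) B) (λ ν _ → trans (∑.big-map (ν ∷_) (paths ls ν μ) _)
             (trans (sym (*-∑ R (w l κ ν) (paths ls ν μ) _)) (*-congˡ (∑-paths ls ν μ)))) ⟩
      ∑-list (filter (rel? l κ) B) (λ ν → w l κ ν * pathSum (map transfer ls) ν μ)
        ≈⟨ ∑.big-filter (rel? l κ) B _ ⟩
      ∑-list B (λ ν → (w l κ ν * pathSum (map transfer ls) ν μ) when rel? l κ ν)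
        ≈⟨ ∑.big-cong B (λ ν _ → when-* R (w l κ ν) _ (rel? l κ ν)) ⟨
      ∑-list B (λ ν → transfer l κ ν * pathSum (map transfer ls) ν μ)  ∎

-- Skew Schur polynomials as sums over chains

≤-from-< : ∀ {m n} → (∀ {j} → j ℕ.< m → j ℕ.< n) → m ℕ.≤ n
≤-from-< {zero}  _ = z≤n
≤-from-< {suc m} h = h ℕₚ.≤-refl

-- The search runs down from `b` to the largest element satisfying `P`; downward closure supplies
-- everything below it.
initial-segment : ∀ {P : ℕ → Set} → Decidable P → ∀ b →
  (∀ {i j} → i ℕ.≤ j → j ℕ.< b → P j → P i) →
  ∃[ c ] (∀ {j} → (j ℕ.< c → j ℕ.< b × P j) × (j ℕ.< b → P j → j ℕ.< c))
initial-segment P? zero    down = 0 , (λ ()) , (λ ())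
initial-segment P? (suc b) down with P? b
... | yes Pb = suc b , (λ j< → j< , down (ℕₚ.≤-pred j<) ℕₚ.≤-refl Pb) , (λ j< _ → j<)
... | no ¬Pb with c , spec ← initial-segment P? b (λ i≤j j<b → down i≤j (ℕₚ.m<n⇒m<1+n j<b))
    = c , (λ j<c → let j<b , Pj = proj₁ spec j<c in ℕₚ.m<n⇒m<1+n j<b , Pj)
    , λ j<1+b Pj → proj₂ spec (ℕₚ.≤∧≢⇒< (ℕₚ.≤-pred j<1+b) (λ { ≡.refl → ¬Pb Pj })) Pj

Cell : Partition → Partition → ℕ → ℕ → Set
Cell κ μ i j = part μ i ℕ.≤ j × j ℕ.< part κ i

∈-cells⁺ : ∀ {κ μ i j} → Cell κ μ i j → (i , j) ∈ cells κ μ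
∈-cells⁺ {κ} {μ} {i} (μ≤j , j<κ) = ∈-concatMap-map⁺ _,_
  (λ i → filter (part μ i ℕₚ.≤?_) (upTo (part κ i)))
  (∈-upTo⁺ (part-support κ (ℕₚ.≤-<-trans z≤n j<κ)))
  (∈-filter⁺ (part μ i ℕₚ.≤?_) (∈-upTo⁺ j<κ) μ≤j)

∈-cells⁻ : ∀ {κ μ i j} → (i , j) ∈ cells κ μ → Cell κ μ i j
∈-cells⁻ {κ} {μ} c∈ with i , j , _ , j∈ , ≡.refl ←
    ∈-concatMap-map⁻ _,_ (λ i → filter (part μ i ℕₚ.≤?_) (upTo (part κ i)))
      (upTo (length (parts κ))) c∈
  with j∈up , μ≤j ← ∈-filter⁻ (part μ i ℕₚ.≤?_) {xs = upTo (part κ i)} j∈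
  = μ≤j , ∈-upTo⁻ j∈up

-- A tableau as a function of coordinates, constrained on the cells of κ/μ alone. Passing to a
-- smaller shape then needs no reindexing of positions.
record SSYT (κ μ : Partition) (T : ℕ → ℕ → ℕ) : Set where
  constructor ssyt
  field
    weak   : ∀ {i j j′} → Cell κ μ i j → Cell κ μ i j′ → j ℕ.≤ j′ → T i j ℕ.≤ T i j′
    strict : ∀ {i i′ j} → Cell κ μ i j → Cell κ μ i′ j → i ℕ.< i′ → T i j ℕ.< T i′ j

-- The cells with entry 0, together with μ, form a partition ν, and decreasing
-- the other entries by 1 yields a tableau of shape κ/ν.
module Peel {κ μ T} (μ⊑κ : μ ⊑ κ) (ssyt-T : SSYT κ μ T) where
  open SSYT ssyt-T

  InFirst : ℕ → ℕ → Set
  InFirst i j = j ℕ.< part μ i ⊎ T i j ≡ 0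

  private
    inFirst? : ∀ i j → Dec (InFirst i j)
    inFirst? i j = (j ℕ.<? part μ i) ⊎-dec (T i j ℕ.≟ 0)

    down : ∀ i {j k} → j ℕ.≤ k → k ℕ.< part κ i → InFirst i k → InFirst i j
    down i j≤k k<κ (inj₁ k<μ) = inj₁ (ℕₚ.≤-<-trans j≤k k<μ)
    down i {j} {k} j≤k k<κ (inj₂ Tk≡0) with j ℕ.<? part μ i
    ... | yes j<μ = inj₁ j<μ
    ... | no  j≮μ = let μ≤j = ℕₚ.≮⇒≥ j≮μ in inj₂ (ℕₚ.n≤0⇒n≡0 (≡.subst (T i j ℕ.≤_) Tk≡0
      (weak (μ≤j , ℕₚ.≤-<-trans j≤k k<κ) (ℕₚ.≤-trans μ≤j j≤k , k<κ) j≤k)))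

    segment : ∀ i → _
    segment i = initial-segment (inFirst? i) (part κ i) (down i)

    f : ℕ → ℕ
    f i = proj₁ (segment i)

    μ≤f : ∀ i → part μ i ℕ.≤ f i
    μ≤f i = ≤-from-< λ j<μ →
      proj₂ (proj₂ (segment i)) (ℕₚ.<-≤-trans j<μ (μ⊑κ i)) (inj₁ j<μ)

    -- A zero in row i + 1 at a column j ≥ μ_i would lie directly below a cell of κ/μ, whose entry
    -- would have to be negative by column strictness.
    f≤μ : ∀ i → f (suc i) ℕ.≤ part μ i
    f≤μ i = ≤-from-< λ j<f → let j<κ , first = proj₁ (proj₂ (segment (suc i))) j<f in go j<κ first
      where
      go : ∀ {j} → j ℕ.< part κ (suc i) → InFirst (suc i) j → j ℕ.< part μ i
      go     _   (inj₁ j<μ) = ℕₚ.<-≤-trans j<μ (part-antitone μ (ℕₚ.n≤1+n i))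
      go {j} j<κ (inj₂ T≡0) with j ℕ.<? part μ i
      ... | yes j<μ = j<μ
      ... | no  j≮μ = let μ≤j = ℕₚ.≮⇒≥ j≮μ in ⊥-elim (ℕₚ.n≮0 (≡.subst (T i j ℕ.<_) T≡0
        (strict (μ≤j , ℕₚ.<-≤-trans j<κ (part-antitone κ (ℕₚ.n≤1+n i)))
                (ℕₚ.≤-trans (part-antitone μ (ℕₚ.n≤1+n i)) μ≤j , j<κ) ℕₚ.≤-refl)))

    first : ∃[ ν ] (∀ i → part ν i ≡ f i)
    first = fromRows f (length (parts κ)) (λ i → ℕₚ.≤-trans (f≤μ i) (μ≤f i))
      (λ i len≤i → ℕₚ.n≤0⇒n≡0 (≤-from-< (λ j<f → ≡.subst (_ ℕ.<_) (nth-beyond (parts κ) len≤i)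
        (proj₁ (proj₁ (proj₂ (segment i)) j<f)))))

  ν : Partition
  ν = proj₁ first

  ν⁺ : ∀ {i j} → j ℕ.< part κ i → InFirst i j → j ℕ.< part ν i
  ν⁺ {i} {j} j<κ inF = ≡.subst (j ℕ.<_) (≡.sym (proj₂ first i)) (proj₂ (proj₂ (segment i)) j<κ inF)

  ν⁻ : ∀ {i j} → j ℕ.< part ν i → j ℕ.< part κ i × InFirst i j
  ν⁻ {i} {j} j<ν = proj₁ (proj₂ (segment i)) (≡.subst (j ℕ.<_) (proj₂ first i) j<ν)

  μ≺ν : μ ≺ ν
  μ≺ν i = ≡.subst (part μ i ℕ.≤_) (≡.sym (proj₂ first i)) (μ≤f i)
        , ≡.subst (ℕ._≤ part μ i) (≡.sym (proj₂ first (suc i))) (f≤μ i)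

  ν⊑κ : ν ⊑ κ
  ν⊑κ i = ≤-from-< (λ j<ν → proj₁ (ν⁻ j<ν))

  positive-outside : ∀ {i j} → Cell κ ν i j → 0 ℕ.< T i j
  positive-outside (ν≤j , j<κ) = ℕₚ.n≢0⇒n>0 (λ T≡0 → ℕₚ.<⇒≱ (ν⁺ j<κ (inj₂ T≡0)) ν≤j)

  widen : ∀ {i j} → Cell κ ν i j → Cell κ μ i j
  widen {i} (ν≤j , j<κ) = ℕₚ.≤-trans (proj₁ (μ≺ν i)) ν≤j , j<κ

  ssyt-pred : SSYT κ ν (λ i j → ℕ.pred (T i j))
  ssyt-pred = ssyt
    (λ c c′ j≤j′ → ℕₚ.pred-mono-≤ (weak (widen c) (widen c′) j≤j′))
    (λ {i} {i′} {j} c c′ i<i′ → pred-mono-< (positive-outside c) (strict (widen c) (widen c′) i<i′))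
    where
    pred-mono-< : ∀ {m n} → 0 ℕ.< m → m ℕ.< n → ℕ.pred m ℕ.< ℕ.pred n
    pred-mono-< {suc m} {suc n} _ (s≤s m<n) = m<n

-- The entry of cell (i, j) in the tableau of the chain νs is the number of
-- shapes of the chain that do not contain the cell.
entry : List Partition → ℕ → ℕ → ℕ
entry []       i j = 0
entry (ν ∷ νs) i j with j ℕ.<? part ν i
... | yes _ = 0
... | no  _ = suc (entry νs i j)

entry-inside : ∀ ν νs {i j} → j ℕ.< part ν i → entry (ν ∷ νs) i j ≡ 0
entry-inside ν νs {i} {j} j<ν with j ℕ.<? part ν i
... | yes _   = ≡.refl
... | no  j≮ν = ⊥-elim (j≮ν j<ν)

entry-outside : ∀ ν νs {i j} → part ν i ℕ.≤ j → entry (ν ∷ νs) i j ≡ suc (entry νs i j)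
entry-outside ν νs {i} {j} ν≤j with j ℕ.<? part ν i
... | yes j<ν = ⊥-elim (ℕₚ.<⇒≱ j<ν ν≤j)
... | no  _   = ≡.refl

∈-fillings : ∀ {n k} (T : Vec (Fin n) k) → T ∈ fillings n k
∈-fillings []               = here ≡.refl
∈-fillings {n} {suc k} (a ∷ T) =
  ∈-concatMap-map⁺ _∷_ (λ _ → fillings n k) (∈-allFin a) (∈-fillings T)

fillings-unique : ∀ n k → Unique (fillings n k)
fillings-unique n zero    = [] ∷ []
fillings-unique n (suc k) = concatMap-map-unique _∷_ (λ _ → fillings n k)
  Vecₚ.∷-injective (λ _ → fillings-unique n k) (Uniqueₚ.allFin⁺ n)

∈-tableaux⁺ : ∀ {κ μ n} {T : Vec (Fin n) (length (cells κ μ))} →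
              Semistandard (cells κ μ) T → T ∈ tableaux κ μ n
∈-tableaux⁺ {κ} {μ} {T = T} = ∈-filter⁺ (semistandard? (cells κ μ)) (∈-fillings T)

∈-tableaux⁻ : ∀ {κ μ n} {T : Vec (Fin n) (length (cells κ μ))} →
              T ∈ tableaux κ μ n → Semistandard (cells κ μ) T
∈-tableaux⁻ {κ} {μ} {n} T∈ = proj₂ (∈-filter⁻ (semistandard? (cells κ μ))
  {xs = fillings n (length (cells κ μ))} T∈)

tableaux-unique : ∀ κ μ n → Unique (tableaux κ μ n)
tableaux-unique κ μ n =
  Uniqueₚ.filter⁺ (semistandard? (cells κ μ)) (fillings-unique n (length (cells κ μ)))

module _ {κ μ : Partition} where

  cell-at : ∀ p → Cell κ μ (row (cells κ μ) {0} p) (col (cells κ μ) {0} p)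
  cell-at p = ∈-cells⁻ {κ} {μ} (∈-lookup p)

  cell-index : ∀ {i j} → Cell κ μ i j →
    ∃[ p ] (row (cells κ μ) {0} p ≡ i × col (cells κ μ) {0} p ≡ j)
  cell-index c = let c∈ = ∈-cells⁺ {κ} {μ} c ; eq = Anyₚ.lookup-index c∈ in
    Any.index c∈ , ≡.cong proj₁ (≡.sym eq) , ≡.cong proj₂ (≡.sym eq)

  module FromFilling {n} {T : Vec (Fin n) (length (cells κ μ))}
                     (semi : Semistandard (cells κ μ) T) where
    private
      cs = cells κ μ
      find? : ∀ i j → Dec (∃[ p ] (row cs {n} p ≡ i × col cs {n} p ≡ j))
      find? i j = Finₚ.any? (λ p → (row cs {n} p ℕₚ.≟ i) ×-dec (col cs {n} p ℕₚ.≟ j))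

    -- The value 0 off the shape is a default that `SSYT` never inspects.
    entryOf : ℕ → ℕ → ℕ
    entryOf i j with find? i j
    ... | yes (p , _) = toℕ (Vec.lookup T p)
    ... | no  _       = 0

    -- Two indices of the same cell carry the same entry, by semistandardness
    -- applied both ways.
    entryOf-at : ∀ {i j} p → row cs {n} p ≡ i → col cs {n} p ≡ j →
                 entryOf i j ≡ toℕ (Vec.lookup T p)
    entryOf-at {i} {j} p r c with find? i j
    ... | yes (q , r′ , c′) = ℕₚ.≤-antisym
      (proj₁ (semi q p) (≡.trans r′ (≡.sym r)) (ℕₚ.≤-reflexive (≡.trans c′ (≡.sym c))))
      (proj₁ (semi p q) (≡.trans r (≡.sym r′)) (ℕₚ.≤-reflexive (≡.trans c (≡.sym c′))))
    ... | no ¬∃ = ⊥-elim (¬∃ (p , r , c))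

    entryOf-ssyt : SSYT κ μ entryOf
    entryOf-ssyt = ssyt weak strict
      where
      weak : ∀ {i j j′} → Cell κ μ i j → Cell κ μ i j′ → j ℕ.≤ j′ → entryOf i j ℕ.≤ entryOf i j′
      weak c c′ j≤j′ with p , r , k ← cell-index c with q , r′ , k′ ← cell-index c′ =
        ≡.subst₂ ℕ._≤_ (≡.sym (entryOf-at p r k)) (≡.sym (entryOf-at q r′ k′))
          (proj₁ (semi p q) (≡.trans r (≡.sym r′)) (≡.subst₂ ℕ._≤_ (≡.sym k) (≡.sym k′) j≤j′))
      strict : ∀ {i i′ j} → Cell κ μ i j → Cell κ μ i′ j → i ℕ.< i′ → entryOf i j ℕ.< entryOf i′ j
      strict c c′ i<i′ with p , r , k ← cell-index c with q , r′ , k′ ← cell-index c′ =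
        ≡.subst₂ ℕ._<_ (≡.sym (entryOf-at p r k)) (≡.sym (entryOf-at q r′ k′))
          (proj₂ (semi p q) (≡.trans k (≡.sym k′)) (≡.subst₂ ℕ._<_ (≡.sym r) (≡.sym r′) i<i′))

    entryOf-< : ∀ {i j} → Cell κ μ i j → entryOf i j ℕ.< n
    entryOf-< c with p , r , k ← cell-index c =
      ≡.subst (ℕ._< n) (≡.sym (entryOf-at p r k)) (Finₚ.toℕ<n _)

module SkewSchur (R : RealField) {B : List Partition} (B! : Unique B)
                 (closed : ∀ {κ μ} → κ ∈ B → μ ⊑ κ → μ ∈ B) where
  open RealField R
  open SetoidReasoning setoid
  open TransferMatrix R B!
  open import Algebra.Properties.Semiring.Exp semiring using (^-homo-*; ^-congʳ)
  private
    module ∏ = BigOp *-commutativeMonoid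
    module ∑ = BigOp +-commutativeMonoid
  open ∏ using (_when_)

  -- On a horizontal strip ν/μ this is the skew Schur polynomial in the single variable `x`.
  stepWeight : Carrier → Kernel
  stepWeight x μ ν = x ^ (size ν ℕ.∸ size μ)

  module Chain = Paths (λ _ → _≺_) (λ _ μ ν → ν ≻? μ) stepWeight
  open Chain

  chain-⊑ : ∀ {xs μ κ νs} → IsPath xs μ κ νs → μ ⊑ κ
  chain-⊑ []              i = ℕₚ.≤-refl
  chain-⊑ ((μ≺ν , _) ∷ c) i = ℕₚ.≤-trans (proj₁ (μ≺ν i)) (chain-⊑ c i)

  -- The chain ends at κ, which contains the cell, so not every shape of the chain omits it.
  entry-< : ∀ {xs μ κ νs i j} → IsPath xs μ κ νs → Cell κ μ i j → entry νs i j ℕ.< length xs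
  entry-< []                          (μ≤j , j<μ) = ⊥-elim (ℕₚ.<⇒≱ j<μ μ≤j)
  entry-< {i = i} {j} (_∷_ {ν = ν} (μ≺ν , _) c) (μ≤j , j<κ) with j ℕ.<? part ν i
  ... | yes j<ν = s≤s z≤n
  ... | no  j≮ν = s≤s (entry-< c (ℕₚ.≮⇒≥ j≮ν , j<κ))

  entry-ssyt : ∀ {xs μ κ νs} → IsPath xs μ κ νs → SSYT κ μ (entry νs)
  entry-ssyt []                                          = ssyt (λ _ _ _ → z≤n)
    (λ (μ≤j , j<μ) _ _ → ⊥-elim (ℕₚ.<⇒≱ j<μ μ≤j))
  entry-ssyt {x ∷ xs} {μ} {κ} {ν ∷ νs} ((μ≺ν , _) ∷ c) = ssyt weak strict
    where
    module IH = SSYT (entry-ssyt c)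
    weak : ∀ {i j j′} → Cell κ μ i j → Cell κ μ i j′ → j ℕ.≤ j′ →
           entry (ν ∷ νs) i j ℕ.≤ entry (ν ∷ νs) i j′
    weak {i} {j} {j′} (_ , j<κ) (_ , j′<κ) j≤j′ with j ℕ.<? part ν i | j′ ℕ.<? part ν i
    ... | yes _   | _        = z≤n
    ... | no  j≮ν | yes j′<ν = ⊥-elim (j≮ν (ℕₚ.≤-<-trans j≤j′ j′<ν))
    ... | no  j≮ν | no  j′≮ν = s≤s (IH.weak (ℕₚ.≮⇒≥ j≮ν , j<κ) (ℕₚ.≮⇒≥ j′≮ν , j′<κ) j≤j′)
    strict : ∀ {i i′ j} → Cell κ μ i j → Cell κ μ i′ j → i ℕ.< i′ →
             entry (ν ∷ νs) i j ℕ.< entry (ν ∷ νs) i′ j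
    strict {i} {i′} {j} (μ≤j , j<κ) (_ , j<κ′) i<i′ with j ℕ.<? part ν i | j ℕ.<? part ν i′
    -- Interlacing gives ν_{i′} ≤ ν_{i+1} ≤ μ_i in zero-based rows: above a cell of the first strip
    -- there is no cell of κ/μ.
    ... | _       | yes j<ν′ = ⊥-elim (ℕₚ.<⇒≱ (ℕₚ.<-≤-trans j<ν′
                                 (ℕₚ.≤-trans (part-antitone ν i<i′) (proj₂ (μ≺ν i)))) μ≤j)
    ... | yes _   | no  _    = s≤s z≤n
    ... | no  j≮ν | no  j≮ν′ = s≤s (IH.strict (ℕₚ.≮⇒≥ j≮ν , j<κ) (ℕₚ.≮⇒≥ j≮ν′ , j<κ′) i<i′)

  -- A cell of ν outside ν′ would have entry 0 in one tableau and a successor in the other. It is a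
  -- cell of κ/μ, where the tableaux agree, because μ lies inside ν′.
  first-shape-⊑ : ∀ {κ μ} ν ν′ νs νs′ → μ ≺ ν′ → ν ⊑ κ →
    (∀ {i j} → Cell κ μ i j → entry (ν ∷ νs) i j ≡ entry (ν′ ∷ νs′) i j) →
    ∀ {i j} → j ℕ.< part ν i → j ℕ.< part ν′ i
  first-shape-⊑ ν ν′ νs νs′ μ≺ν′ ν⊑κ eq {i} {j} j<ν with j ℕ.<? part ν′ i
  ... | yes j<ν′ = j<ν′
  ... | no  j≮ν′ = let ν′≤j = ℕₚ.≮⇒≥ j≮ν′ in ⊥-elim (ℕₚ.0≢1+n (≡.trans
    (≡.sym (entry-inside ν νs j<ν))
    (≡.trans (eq (ℕₚ.≤-trans (proj₁ (μ≺ν′ i)) ν′≤j , ℕₚ.<-≤-trans j<ν (ν⊑κ i)))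
             (entry-outside ν′ νs′ ν′≤j))))

  -- The zero entries determine the first shape; lowering the others by 1 leaves the tableau of the
  -- remaining chain.
  entry-injective : ∀ {xs μ κ νs νs′} → IsPath xs μ κ νs → IsPath xs μ κ νs′ →
    (∀ {i j} → Cell κ μ i j → entry νs i j ≡ entry νs′ i j) → νs ≡ νs′
  entry-injective []               []               eq = ≡.refl
  entry-injective {x ∷ xs} {μ} {κ} {ν ∷ νs} {ν′ ∷ νs′} ((μ≺ν , _) ∷ c) ((μ≺ν′ , _) ∷ c′) eq
    with ≡.refl ← part-injective {ν} {ν′} (λ i → ℕₚ.≤-antisym
           (≤-from-< (first-shape-⊑ {κ} {μ} ν ν′ νs νs′ μ≺ν′ (chain-⊑ c) eq))
           (≤-from-< (first-shape-⊑ {κ} {μ} ν′ ν νs′ νs μ≺ν (chain-⊑ c′) (≡.sym ∘ eq))))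
    = ≡.cong (ν ∷_) (entry-injective c c′ λ {i} {j} (ν≤j , j<κ) → ℕₚ.suc-injective
        (≡.trans (≡.sym (entry-outside ν νs ν≤j))
          (≡.trans (eq (ℕₚ.≤-trans (proj₁ (μ≺ν i)) ν≤j , j<κ)) (entry-outside ν νs′ ν≤j))))

  -- Peeling off the zero entries produces the chain one shape at a time. Every shape is contained
  -- in κ, so it stays in the ideal `B`.
  entry-surjective : ∀ xs {μ κ T} → κ ∈ B → μ ⊑ κ → SSYT κ μ T →
    (∀ {i j} → Cell κ μ i j → T i j ℕ.< length xs) →
    ∃[ νs ] (IsPath xs μ κ νs × (∀ {i j} → Cell κ μ i j → T i j ≡ entry νs i j))
  entry-surjective [] {μ} {κ} κ∈ μ⊑κ _ T<
    with ≡.refl ← part-injective {μ} {κ} (λ i → ℕₚ.≤-antisym (μ⊑κ i) (ℕₚ.≮⇒≥ λ μ<κ →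
           ℕₚ.n≮0 (T< (ℕₚ.≤-refl , μ<κ))))
    = [] , [] , (λ c → ⊥-elim (ℕₚ.n≮0 (T< c)))
  entry-surjective (x ∷ xs) {μ} {κ} {T} κ∈ μ⊑κ ssyt-T T<
    = ν ∷ νs , (μ≺ν , closed κ∈ ν⊑κ) ∷ proj₁ (proj₂ rest) , agree′
    where
    open Peel {κ} {μ} {T} μ⊑κ ssyt-T
    rest = entry-surjective xs κ∈ ν⊑κ ssyt-pred
      (λ {i} {j} c → ℕₚ.<-≤-trans
        (ℕₚ.≤-reflexive (ℕₚ.suc-pred (T i j) {{ℕ.>-nonZero (positive-outside c)}}))
        (ℕₚ.≤-pred (T< (widen c))))
    νs = proj₁ rest
    agree′ : ∀ {i j} → Cell κ μ i j → T i j ≡ entry (ν ∷ νs) i j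
    agree′ {i} {j} (μ≤j , j<κ) with j ℕ.<? part ν i
    agree′ (μ≤j , j<κ) | yes j<ν with proj₂ (ν⁻ j<ν)
    ... | inj₁ j<μ = ⊥-elim (ℕₚ.<⇒≱ j<μ μ≤j)
    ... | inj₂ T≡0 = T≡0
    agree′ {i} {j} (μ≤j , j<κ) | no j≮ν = let c = ℕₚ.≮⇒≥ j≮ν , j<κ in ≡.trans
      (≡.sym (ℕₚ.suc-pred (T i j) {{ℕ.>-nonZero (positive-outside c)}})) (≡.cong suc (proj₂ (proj₂ rest) c))

  -- Indexing by plain naturals lets entries be shifted by 1 without carrying bounds; `1#` is a
  -- default past the end.
  at : List Carrier → ℕ → Carrier
  at []       _       = 1#
  at (x ∷ xs) zero    = x
  at (x ∷ xs) (suc n) = at xs n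

  at-lookup : ∀ xs (a : Fin (length xs)) → List.lookup xs a ≡ at xs (toℕ a)
  at-lookup (x ∷ xs) Fin.zero    = ≡.refl
  at-lookup (x ∷ xs) (Fin.suc a) = at-lookup xs a

  ∏-upTo-suc : ∀ n (f : ℕ → Carrier) → ∏-list (List.applyUpTo suc n) f ≈ ∏-list (upTo n) (f ∘ suc)
  ∏-upTo-suc n f = trans
    (reflexive (≡.cong (λ is → ∏-list is f) (≡.sym (Listₚ.map-applyUpTo id suc n))))
    (∏.big-map suc (upTo n) f)

  ∏-interval : ∀ x {n} m k → n ℕ.≤ k →
    ∏-list (upTo k) (λ j → x when ((m ℕₚ.≤? j) ×-dec (j ℕ.<? n))) ≈ x ^ (n ℕ.∸ m)
  ∏-interval x {zero} m k n≤k = trans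
    (∏.big-ε (upTo k) (λ j _ → ∏.when-no ((m ℕₚ.≤? j) ×-dec (j ℕ.<? 0)) (ℕₚ.n≮0 ∘ proj₂)))
    (^-congʳ x (≡.sym (ℕₚ.0∸n≡0 m)))
  ∏-interval x {suc n} m (suc k) (s≤s n≤k) =
    trans (*-congˡ (∏-upTo-suc k (λ j → x when ((m ℕₚ.≤? j) ×-dec (j ℕ.<? suc n))))) (by-start m)
    where
    by-start : ∀ m → (x when ((m ℕₚ.≤? 0) ×-dec (0 ℕ.<? suc n))) *
      ∏-list (upTo k) (λ j → x when ((m ℕₚ.≤? suc j) ×-dec (suc j ℕ.<? suc n)))
      ≈ x ^ (suc n ℕ.∸ m)
    by-start zero    = *-cong (∏.when-yes ((0 ℕₚ.≤? 0) ×-dec (0 ℕ.<? suc n)) (z≤n , s≤s z≤n))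
      (trans (∏.big-cong (upTo k) (λ j _ → ∏.when-cong
               ((0 ℕₚ.≤? suc j) ×-dec (suc j ℕ.<? suc n)) ((0 ℕₚ.≤? j) ×-dec (j ℕ.<? n))
               (λ (_ , j<n) → z≤n , ℕₚ.≤-pred j<n) (λ (_ , j<n) → z≤n , s≤s j<n) (λ _ → refl)))
             (∏-interval x 0 k n≤k))
    by-start (suc m) = trans
      (*-congʳ (∏.when-no {x = x} ((suc m ℕₚ.≤? 0) ×-dec (0 ℕ.<? suc n)) (ℕₚ.n≮0 ∘ proj₁)))
      (trans (*-identityˡ _)
        (trans (∏.big-cong (upTo k) (λ j _ → ∏.when-cong
                 ((suc m ℕₚ.≤? suc j) ×-dec (suc j ℕ.<? suc n)) ((m ℕₚ.≤? j) ×-dec (j ℕ.<? n))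
                 (λ (m≤j , j<n) → ℕₚ.≤-pred m≤j , ℕₚ.≤-pred j<n)
                 (λ (m≤j , j<n) → s≤s m≤j , s≤s j<n) (λ _ → refl)))
               (∏-interval x m k n≤k)))

  ∏-^ : ∀ {A : Set} x (as : List A) g → ∏-list as (λ a → x ^ g a) ≈ x ^ sum (map g as)
  ∏-^ x []       g = refl
  ∏-^ x (a ∷ as) g = trans (*-congˡ (∏-^ x as g)) (sym (^-homo-* x (g a) (sum (map g as))))

  ∏-cells : ∀ κ μ f → ∏-list (cells κ μ) f ≈
    ∏-list (upTo (length (parts κ))) (λ i →
      ∏-list (upTo (part κ i)) (λ j → f (i , j) when (part μ i ℕₚ.≤? j)))
  ∏-cells κ μ f = trans (∏.big-concatMap _ (upTo (length (parts κ))) f)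
    (∏.big-cong (upTo (length (parts κ))) (λ i _ → trans
      (∏.big-map (i ,_) (filter (part μ i ℕₚ.≤?_) (upTo (part κ i))) f)
      (∏.big-filter (part μ i ℕₚ.≤?_) (upTo (part κ i)) (λ j → f (i , j)))))

  ∏-skew-cells : ∀ x {κ μ ν} → μ ⊑ ν → ν ⊑ κ →
    ∏-list (upTo (length (parts κ))) (λ i →
      ∏-list (upTo (part κ i)) (λ j → x when ((part μ i ℕₚ.≤? j) ×-dec (j ℕ.<? part ν i))))
    ≈ x ^ (size ν ℕ.∸ size μ)
  ∏-skew-cells x {κ} {μ} {ν} μ⊑ν ν⊑κ = trans
    (∏.big-cong (upTo (length (parts κ))) (λ i _ → ∏-interval x (part μ i) (part κ i) (ν⊑κ i)))
    (trans (∏-^ x (upTo (length (parts κ))) (λ i → part ν i ℕ.∸ part μ i))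
           (^-congʳ x (size-∸ {ν} {μ} μ⊑ν (⊑-length {ν} {κ} ν⊑κ))))

  -- The cells of κ/μ split into those of ν/μ, with entry 0 and factor `x` each, and those of κ/ν,
  -- whose entries are one more than in the tableau of the remaining chain.
  ∏-entry : ∀ {xs μ κ νs} → IsPath xs μ κ νs →
    ∏-list (cells κ μ) (λ (i , j) → at xs (entry νs i j)) ≈ pathWeight xs μ νs
  ∏-entry {κ = κ} [] = trans (∏-cells κ κ _) (∏.big-ε (upTo (length (parts κ))) λ i _ →
    ∏.big-ε (upTo (part κ i)) λ j j∈ →
      ∏.when-no (part κ i ℕₚ.≤? j) (ℕₚ.<⇒≱ (∈-upTo⁻ j∈)))
  ∏-entry {x ∷ xs} {μ} {κ} {ν ∷ νs} ((μ≺ν , _) ∷ c) = begin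
    ∏-list (cells κ μ) (λ (i , j) → at (x ∷ xs) (entry (ν ∷ νs) i j))
      ≈⟨ ∏-cells κ μ _ ⟩
    ∏-list rows (λ i → ∏-list (upTo (part κ i)) (λ j →
      at (x ∷ xs) (entry (ν ∷ νs) i j) when (part μ i ℕₚ.≤? j)))
      ≈⟨ ∏.big-cong rows (λ i _ → trans
           (∏.big-cong (upTo (part κ i)) (λ j _ → split i j)) (∏.big-∙ (upTo (part κ i)) _ _)) ⟩
    ∏-list rows (λ i →
      ∏-list (upTo (part κ i)) (λ j → x when ((part μ i ℕₚ.≤? j) ×-dec (j ℕ.<? part ν i))) *
      ∏-list (upTo (part κ i)) (λ j → at xs (entry νs i j) when (part ν i ℕₚ.≤? j)))
      ≈⟨ ∏.big-∙ rows _ _ ⟩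
    ∏-list rows (λ i →
      ∏-list (upTo (part κ i)) (λ j → x when ((part μ i ℕₚ.≤? j) ×-dec (j ℕ.<? part ν i)))) *
    ∏-list rows (λ i →
      ∏-list (upTo (part κ i)) (λ j → at xs (entry νs i j) when (part ν i ℕₚ.≤? j)))
      ≈⟨ *-cong (∏-skew-cells x {κ} {μ} {ν} (≻⇒⊒ {ν} {μ} μ≺ν) (chain-⊑ c)) (sym (∏-cells κ ν _)) ⟩
    x ^ (size ν ℕ.∸ size μ) * ∏-list (cells κ ν) (λ (i , j) → at xs (entry νs i j))
      ≈⟨ *-congˡ (∏-entry c) ⟩
    x ^ (size ν ℕ.∸ size μ) * pathWeight xs ν νs  ∎
    where
    rows = upTo (length (parts κ))
    split : ∀ i j → at (x ∷ xs) (entry (ν ∷ νs) i j) when (part μ i ℕₚ.≤? j) ≈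
      (x when ((part μ i ℕₚ.≤? j) ×-dec (j ℕ.<? part ν i))) *
      (at xs (entry νs i j) when (part ν i ℕₚ.≤? j))
    split i j with part ν i ℕₚ.≤? j
    ... | yes ν≤j = trans
      (trans (∏.when-yes (part μ i ℕₚ.≤? j) (ℕₚ.≤-trans (proj₁ (μ≺ν i)) ν≤j))
             (trans (reflexive (≡.cong (at (x ∷ xs)) (entry-outside ν νs ν≤j))) (sym (*-identityˡ _))))
      (sym (*-cong (∏.when-no ((part μ i ℕₚ.≤? j) ×-dec (j ℕ.<? part ν i))
                              (λ (_ , j<ν) → ℕₚ.<⇒≱ j<ν ν≤j))
                   (∏.when-yes (part ν i ℕₚ.≤? j) ν≤j)))
    ... | no  ν≰j = let j<ν = ℕₚ.≰⇒> ν≰j in trans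
      (∏.when-cong (part μ i ℕₚ.≤? j) ((part μ i ℕₚ.≤? j) ×-dec (j ℕ.<? part ν i))
        (_, j<ν) proj₁ (λ _ → reflexive (≡.cong (at (x ∷ xs)) (entry-inside ν νs j<ν))))
      (sym (trans (*-congˡ (∏.when-no (part ν i ℕₚ.≤? j) ν≰j)) (*-identityʳ _)))

  ∏-filling : ∀ xs cs (T : Vec (Fin (length xs)) (length cs)) (g : ℕ × ℕ → ℕ) →
    (∀ p → toℕ (Vec.lookup T p) ≡ g (List.lookup cs p)) →
    ∏-list (Vec.toList T) (List.lookup xs) ≈ ∏-list cs (λ c → at xs (g c))
  ∏-filling xs []       []      g T≡g = refl
  ∏-filling xs (c ∷ cs) (a ∷ T) g T≡g = *-cong
    (reflexive (≡.trans (at-lookup xs a) (≡.cong (at xs) (T≡g Fin.zero))))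
    (∏-filling xs cs T g (T≡g ∘ Fin.suc))

  -- The bijection is the relation `Enc`: a filling and a chain correspond when they agree at every
  -- listed cell.
  ∑-tableaux : ∀ {κ} μ xs → κ ∈ B → μ ⊑ κ →
    ∑-list (tableaux κ μ (length xs)) (λ T → ∏-list (Vec.toList T) (List.lookup xs)) ≈
    ∑-list (paths xs μ κ) (pathWeight xs μ)
  ∑-tableaux {κ} μ xs κ∈ μ⊑κ = sym (big-bijection +-commutativeMonoid Enc
    (paths-unique xs μ κ) (tableaux-unique κ μ (length xs)) tot surj
    (λ {νs} {νs′} {T} p p′ enc enc′ → entry-injective (∈-paths⁻ xs p) (∈-paths⁻ xs p′)
      (agree {νs} {νs′} {T} enc enc′))
    (λ _ _ enc enc′ → ext (λ p → Finₚ.toℕ-injective (≡.trans (enc p) (≡.sym (enc′ p)))))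
    (λ {νs} {T} p enc → sym (trans (∏-filling xs cs T (λ (i , j) → entry νs i j) enc) (∏-entry (∈-paths⁻ xs p)))))
    where
    cs = cells κ μ
    n = length xs
    Enc : List Partition → Vec (Fin n) (length cs) → Set
    Enc νs T = ∀ p → toℕ (Vec.lookup T p) ≡ entry νs (row cs {n} p) (col cs {n} p)
    ext : ∀ {T T′ : Vec (Fin n) (length cs)} → (∀ p → Vec.lookup T p ≡ Vec.lookup T′ p) → T ≡ T′
    ext {T} {T′} eq = ≡.trans (≡.sym (Vecₚ.tabulate∘lookup T))
      (≡.trans (Vecₚ.tabulate-cong eq) (Vecₚ.tabulate∘lookup T′))
    agree : ∀ {νs νs′ T} → Enc νs T → Enc νs′ T → ∀ {i j} → Cell κ μ i j →
            entry νs i j ≡ entry νs′ i j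
    agree enc enc′ c with p , ≡.refl , ≡.refl ← cell-index {κ} {μ} c =
      ≡.trans (≡.sym (enc p)) (enc′ p)
    tot : ∀ {νs} → νs ∈ paths xs μ κ → ∃[ T ] (T ∈ tableaux κ μ n × Enc νs T)
    tot {νs} νs∈ = T , ∈-tableaux⁺ {κ} {μ} semi , T-at
      where
      c = ∈-paths⁻ xs νs∈
      open SSYT (entry-ssyt c)
      T = Vec.tabulate (λ p → fromℕ< (entry-< c (cell-at {κ} {μ} p)))
      T-at : Enc νs T
      T-at p = ≡.trans (≡.cong toℕ (Vecₚ.lookup∘tabulate _ p)) (Finₚ.toℕ-fromℕ< _)
      semi : Semistandard cs T
      semi p q =
        (λ r≡ c≤ → ≡.subst₂ ℕ._≤_ (≡.sym (T-at p)) (≡.sym (T-at q))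
          (≡.subst (λ i → entry νs i _ ℕ.≤ _) (≡.sym r≡)
            (weak (≡.subst (λ i → Cell κ μ i _) r≡ (cell-at {κ} {μ} p)) (cell-at {κ} {μ} q) c≤)))
        , (λ c≡ r< → ≡.subst₂ ℕ._<_ (≡.sym (T-at p)) (≡.sym (T-at q))
          (≡.subst (λ j → entry νs _ j ℕ.< _) (≡.sym c≡)
            (strict (≡.subst (λ j → Cell κ μ _ j) c≡ (cell-at {κ} {μ} p)) (cell-at {κ} {μ} q) r<)))
    surj : ∀ {T} → T ∈ tableaux κ μ n → ∃[ νs ] (νs ∈ paths xs μ κ × Enc νs T)
    surj {T} T∈ =
      let open FromFilling {κ} {μ} {n} {T} (∈-tableaux⁻ {κ} {μ} T∈)
          νs , c , eq = entry-surjective xs κ∈ μ⊑κ entryOf-ssyt entryOf-<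
      in νs , ∈-paths⁺ c , λ p → ≡.trans (≡.sym (entryOf-at p ≡.refl ≡.refl))
                                        (eq (cell-at {κ} {μ} p))

  -- If μ is not contained in κ, the polynomial is 0 by definition, and no chain leads from μ to κ
  -- because chains only grow.
  skewSchur-pathSum : ∀ {κ} μ xs → κ ∈ B → skewSchur R κ μ xs ≈ pathSum (map transfer xs) μ κ
  skewSchur-pathSum {κ} μ xs κ∈ with μ ⊆? κ
  ... | yes μ⊆κ = trans (∑-tableaux μ xs κ∈ (⊆⇒⊑ {μ} {κ} μ⊆κ)) (∑-paths xs μ κ)
  ... | no  μ⊈κ = trans (sym (∑.big-ε (paths xs μ κ) (λ νs νs∈ →
                    ⊥-elim (μ⊈κ (⊑⇒⊆ {μ} {κ} (chain-⊑ (∈-paths⁻ xs νs∈))))))) (∑-paths xs μ κ)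

-- Integer intervals and corners

<⇒+1≤ : ∀ {a b} → a ℤ.< b → a ℤ.+ 1ℤ ℤ.≤ b
<⇒+1≤ {a} {b} a<b = ≡.subst (ℤ._≤ b) (ℤₚ.+-comm 1ℤ a) (ℤₚ.i<j⇒suc[i]≤j a<b)

+1≤⇒< : ∀ {a b} → a ℤ.+ 1ℤ ℤ.≤ b → a ℤ.< b
+1≤⇒< {a} {b} a+1≤b = ℤₚ.suc[i]≤j⇒i<j (≡.subst (ℤ._≤ b) (ℤₚ.+-comm a 1ℤ) a+1≤b)

<+1⇒≤ : ∀ {a b} → a ℤ.< b ℤ.+ 1ℤ → a ℤ.≤ b
<+1⇒≤ {a} {b} a<b+1 = ≡.subst (a ℤ.≤_)
  (≡.trans (≡.cong ℤ.pred (ℤₚ.+-comm b 1ℤ)) (ℤₚ.pred-suc b)) (ℤₚ.i<j⇒i≤pred[j] a<b+1)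

≤⇒<+1 : ∀ {a b} → a ℤ.≤ b → a ℤ.< b ℤ.+ 1ℤ
≤⇒<+1 a≤b = +1≤⇒< (ℤₚ.+-monoˡ-≤ 1ℤ a≤b)

+suc : ∀ a k → a ℤ.+ + suc k ≡ (a ℤ.+ 1ℤ) ℤ.+ + k
+suc a k = ≡.sym (ℤₚ.+-assoc a 1ℤ (+ k))

i+[j-i]≡j : ∀ i j → i ℤ.+ (j ℤ.- i) ≡ j
i+[j-i]≡j i j = ≡.trans (ℤₚ.+-comm i (j ℤ.- i)) (≡.trans (ℤₚ.+-assoc j (ℤ.- i) i)
  (≡.trans (≡.cong (λ e → j ℤ.+ e) (ℤₚ.+-inverseˡ i)) (ℤₚ.+-identityʳ j)))

offset : ∀ {a b} → a ℤ.≤ b → ∃[ k ] b ≡ a ℤ.+ + k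
offset {a} {b} a≤b = ℤ.∣ b ℤ.- a ∣ , ≡.sym (≡.trans
  (≡.cong (λ e → a ℤ.+ e) (ℤₚ.0≤i⇒+∣i∣≡i (ℤₚ.i≤j⇒0≤j-i a≤b))) (i+[j-i]≡j a b))

-- An interval given by start and length, the form on which induction works.
run : ℤ → ℕ → List ℤ
run a zero    = []
run a (suc k) = a ∷ run (a ℤ.+ 1ℤ) k

interval-run : ∀ a k → [ a , a ℤ.+ + k ⟩ ≡ run a k
interval-run a k = ≡.trans
  (≡.cong (λ l → map (λ j → a ℤ.+ + j) (upTo l)) length≡k) (map-upTo a k)
  where
  length≡k : ℤ.∣ (a ℤ.+ + k ℤ.- a) ℤ.⊔ 0ℤ ∣ ≡ k
  length≡k = ≡.trans
    (≡.cong (λ d → ℤ.∣ d ℤ.⊔ 0ℤ ∣) (≡.trans (ℤₚ.+-assoc a (+ k) (ℤ.- a)) (i+[j-i]≡j a (+ k))))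
    (ℕₚ.⊔-identityʳ k)
  map-upTo : ∀ a k → map (λ j → a ℤ.+ + j) (upTo k) ≡ run a k
  map-upTo a zero    = ≡.refl
  map-upTo a (suc k) = ≡.cong₂ _∷_ (ℤₚ.+-identityʳ a) (≡.trans
    (≡.trans (≡.cong (map (λ j → a ℤ.+ + j)) (≡.sym (Listₚ.map-applyUpTo id suc k)))
      (≡.trans (≡.sym (Listₚ.map-∘ (upTo k))) (Listₚ.map-cong (+suc a) (upTo k))))
    (map-upTo (a ℤ.+ 1ℤ) k))

run-++ : ∀ a j k → run a (j ℕ.+ k) ≡ run a j ++ run (a ℤ.+ + j) k
run-++ a zero    k = ≡.cong (λ b → run b k) (≡.sym (ℤₚ.+-identityʳ a))
run-++ a (suc j) k = ≡.cong (a ∷_) (≡.trans (run-++ (a ℤ.+ 1ℤ) j k)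
  (≡.cong (λ b → run (a ℤ.+ 1ℤ) j ++ run b k) (≡.sym (+suc a j))))

a≤a+k : ∀ a k → a ℤ.≤ a ℤ.+ + k
a≤a+k a k = ℤₚ.i≤i+j a (+ k)

+-cancel-< : ∀ a {j k} → a ℤ.+ + j ℤ.< a ℤ.+ + k → j ℕ.< k
+-cancel-< a {j} {k} a+j<a+k with j ℕ.<? k
... | yes j<k = j<k
... | no  j≮k = ⊥-elim (ℤₚ.<⇒≱ a+j<a+k (ℤₚ.+-monoʳ-≤ a (ℤ.+≤+ (ℕₚ.≮⇒≥ j≮k))))

∈-run⁻ : ∀ {m} a k → m ∈ run a k → a ℤ.≤ m × m ℤ.< a ℤ.+ + k
∈-run⁻ a (suc k) (here ≡.refl) = ℤₚ.≤-refl , +1≤⇒< (ℤₚ.+-monoʳ-≤ a (ℤ.+≤+ (s≤s z≤n)))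
∈-run⁻ {m} a (suc k) (there m∈) = let a+1≤m , m< = ∈-run⁻ (a ℤ.+ 1ℤ) k m∈ in
  ℤₚ.<⇒≤ (+1≤⇒< a+1≤m) , ≡.subst (m ℤ.<_) (≡.sym (+suc a k)) m<

∈-run⁺ : ∀ a {j} k → j ℕ.< k → a ℤ.+ + j ∈ run a k
∈-run⁺ a {zero}  (suc k) _         = here (ℤₚ.+-identityʳ a)
∈-run⁺ a {suc j} (suc k) (s≤s j<k) =
  there (≡.subst (_∈ run (a ℤ.+ 1ℤ) k) (≡.sym (+suc a j)) (∈-run⁺ (a ℤ.+ 1ℤ) k j<k))

∈-interval⁺ : ∀ {a b m} → a ℤ.≤ m → m ℤ.< b → m ∈ [ a , b ⟩
∈-interval⁺ {a} a≤m m<b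
  with j , ≡.refl ← offset a≤m
  with k , ≡.refl ← offset (ℤₚ.≤-trans a≤m (ℤₚ.<⇒≤ m<b))
  = ≡.subst (_ ∈_) (≡.sym (interval-run a k)) (∈-run⁺ a k (+-cancel-< a m<b))

∈-interval⁻ : ∀ {a b m} → a ℤ.≤ b → m ∈ [ a , b ⟩ → a ℤ.≤ m × m ℤ.< b
∈-interval⁻ {a} a≤b m∈ with k , ≡.refl ← offset a≤b =
  ∈-run⁻ a k (≡.subst (_ ∈_) (interval-run a k) m∈)

interval-++ : ∀ {a b c} → a ℤ.≤ b → b ℤ.≤ c → [ a , c ⟩ ≡ [ a , b ⟩ ++ [ b , c ⟩
interval-++ {a} a≤b b≤c
  with j , ≡.refl ← offset a≤b
  with k , ≡.refl ← offset b≤c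
  = ≡.trans (≡.cong [ a ,_⟩ (ℤₚ.+-assoc a (+ j) (+ k)))
      (≡.trans (interval-run a (j ℕ.+ k)) (≡.trans (run-++ a j k)
        (≡.cong₂ _++_ (≡.sym (interval-run a j)) (≡.sym (interval-run (a ℤ.+ + j) k)))))

interval-∷ : ∀ {a b} → a ℤ.< b → [ a , b ⟩ ≡ a ∷ [ a ℤ.+ 1ℤ , b ⟩
interval-∷ {a} a<b with k , ≡.refl ← offset (<⇒+1≤ a<b) =
  ≡.trans (≡.cong [ a ,_⟩ (≡.sym (+suc a k)))
    (≡.trans (interval-run a (suc k)) (≡.cong (a ∷_) (≡.sym (interval-run (a ℤ.+ 1ℤ) k))))

interval-[] : ∀ a → [ a , a ⟩ ≡ []
interval-[] a = ≡.trans (≡.cong [ a ,_⟩ (≡.sym (ℤₚ.+-identityʳ a))) (interval-run a 0)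

increasing : ∀ {N} (u : Fin (suc N) → ℤ) → (∀ i → u (inject₁ i) ℤ.≤ u (Fin.suc i)) →
             ∀ {i j} → i Fin.≤ j → u i ℤ.≤ u j
increasing         u step {Fin.zero}  {Fin.zero}  _         = ℤₚ.≤-refl
increasing {suc N} u step {Fin.zero}  {Fin.suc j} _         =
  ℤₚ.≤-trans (step Fin.zero) (increasing (u ∘ Fin.suc) (step ∘ Fin.suc) {Fin.zero} {j} z≤n)
increasing {suc N} u step {Fin.suc i} {Fin.suc j} (s≤s i≤j) =
  increasing (u ∘ Fin.suc) (step ∘ Fin.suc) i≤j

interval-concat : ∀ {N} (u : Fin (suc N) → ℤ) (v : Fin N → ℤ) →
  (∀ i → u (inject₁ i) ℤ.≤ v i) → (∀ i → v i ℤ.≤ u (Fin.suc i)) →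
  [ u Fin.zero , u (fromℕ N) ⟩ ≡
  concat (tabulate (λ i → [ u (inject₁ i) , v i ⟩ ++ [ v i , u (Fin.suc i) ⟩))
interval-concat {zero}  u v u≤v v≤u = interval-[] (u Fin.zero)
interval-concat {suc N} u v u≤v v≤u = ≡.trans
  (interval-++ (ℤₚ.≤-trans (u≤v Fin.zero) (v≤u Fin.zero))
    (increasing (u ∘ Fin.suc) (λ i → ℤₚ.≤-trans (u≤v (Fin.suc i)) (v≤u (Fin.suc i)))
      {Fin.zero} {fromℕ N} z≤n))
  (≡.cong₂ _++_ (interval-++ (u≤v Fin.zero) (v≤u Fin.zero))
    (interval-concat (u ∘ Fin.suc) (v ∘ Fin.suc) (u≤v ∘ Fin.suc) (v≤u ∘ Fin.suc)))

module CornerProperties {N : ℕ} (C : Corners N) where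
  open Corners C

  u-mono : ∀ {i j} → i Fin.≤ j → u i ℤ.≤ u j
  u-mono = increasing u (λ i → ℤₚ.<⇒≤ (ℤₚ.<-trans (u<v i) (v<u i)))

  u-gap : ∀ {i j} → i Fin.< j → u (Fin.suc i) ℤ.≤ u (inject₁ j)
  u-gap {i} {j} i<j = u-mono (≡.subst (suc (toℕ i) ℕ.≤_) (≡.sym (Finₚ.toℕ-inject₁ j)) i<j)

  uFirst≤ : ∀ i → uFirst ℤ.≤ u i
  uFirst≤ i = u-mono {Fin.zero} {i} z≤n

  ≤uLast : ∀ i → u i ℤ.≤ uLast
  ≤uLast i = u-mono (Finₚ.≤fromℕ i)

  uFirst<v : ∀ i → uFirst ℤ.< v i
  uFirst<v i = ℤₚ.≤-<-trans (uFirst≤ (inject₁ i)) (u<v i)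

  v<uLast : ∀ i → v i ℤ.< uLast
  v<uLast i = ℤₚ.<-≤-trans (v<u i) (≤uLast (Fin.suc i))

  -- Two stretches with different indices are separated by some `u`, two with the same index by
  -- `v i`. Hence at each step only one of the two interlacing conditions has content.
  D⁻∩D⁺≡∅ : ∀ {m} → D⁻ m → D⁺ m → ⊥
  D⁻∩D⁺≡∅ (i , u≤m , m<v) (j , v≤m , m<u) with Finₚ.<-cmp i j
  ... | tri< i<j _ _ = ℤₚ.<⇒≱ m<v (ℤₚ.≤-trans (ℤₚ.<⇒≤ (v<u i))
                         (ℤₚ.≤-trans (u-gap i<j) (ℤₚ.≤-trans (ℤₚ.<⇒≤ (u<v j)) v≤m)))
  ... | tri≈ _ ≡.refl _ = ℤₚ.<⇒≱ m<v v≤m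
  ... | tri> _ _ j<i = ℤₚ.<⇒≱ m<u (ℤₚ.≤-trans (u-gap j<i) u≤m)

  D⁺-unique : ∀ {m i j} → v i ℤ.≤ m → m ℤ.< u (Fin.suc i) → v j ℤ.≤ m → m ℤ.< u (Fin.suc j) → i ≡ j
  D⁺-unique {m} {i} {j} vi≤m m<ui vj≤m m<uj with Finₚ.<-cmp i j
  ... | tri< i<j _ _ = ⊥-elim (ℤₚ.<⇒≱ m<ui
                         (ℤₚ.≤-trans (u-gap i<j) (ℤₚ.≤-trans (ℤₚ.<⇒≤ (u<v j)) vj≤m)))
  ... | tri≈ _ i≡j _ = i≡j
  ... | tri> _ _ j<i = ⊥-elim (ℤₚ.<⇒≱ m<uj
                         (ℤₚ.≤-trans (u-gap j<i) (ℤₚ.≤-trans (ℤₚ.<⇒≤ (u<v i)) vi≤m)))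

  steps : List ℤ
  steps = [ uFirst , uLast ⟩

  pieces : Fin N → List ℤ
  pieces i = [ u (inject₁ i) , v i ⟩ ++ [ v i , u (Fin.suc i) ⟩

  steps-concat : steps ≡ concat (tabulate pieces)
  steps-concat = interval-concat u v (ℤₚ.<⇒≤ ∘ u<v) (ℤₚ.<⇒≤ ∘ v<u)

  uFirst≤uLast : uFirst ℤ.≤ uLast
  uFirst≤uLast = uFirst≤ (fromℕ N)

  in-piece : ∀ {m} → uFirst ℤ.≤ m → m ℤ.< uLast →
    ∃[ i ] ((u (inject₁ i) ℤ.≤ m × m ℤ.< v i) ⊎ (v i ℤ.≤ m × m ℤ.< u (Fin.suc i)))
  in-piece {m} u≤m m<u
    with p , m∈p , p∈ ← ∈-concat⁻′ (tabulate pieces)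
                          (≡.subst (m ∈_) steps-concat (∈-interval⁺ u≤m m<u))
    with i , ≡.refl ← ∈-tabulate⁻ p∈
    with ∈-++⁻ [ u (inject₁ i) , v i ⟩ m∈p
  ... | inj₁ m∈ = i , inj₁ (∈-interval⁻ (ℤₚ.<⇒≤ (u<v i)) m∈)
  ... | inj₂ m∈ = i , inj₂ (∈-interval⁻ (ℤₚ.<⇒≤ (v<u i)) m∈)

-- Configurations as paths

-- Constant up to `a` and from the last entry on. When both end values are `∅`, these constant tails
-- are the boundary conditions of a configuration.
extend : ℤ → Partition → List Partition → ℤ → Partition
extend a s []       t = s
extend a s (c ∷ cs) t with t ℤₚ.≤? a
... | yes _ = s
... | no  _ = extend (a ℤ.+ 1ℤ) c cs t

extend-≤ : ∀ a s cs {t} → t ℤ.≤ a → extend a s cs t ≡ s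
extend-≤ a s []           t≤a = ≡.refl
extend-≤ a s (c ∷ cs) {t} t≤a with t ℤₚ.≤? a
... | yes _   = ≡.refl
... | no  t≰a = ⊥-elim (t≰a t≤a)

extend-> : ∀ a s c cs {t} → a ℤ.< t → extend a s (c ∷ cs) t ≡ extend (a ℤ.+ 1ℤ) c cs t
extend-> a s c cs {t} a<t with t ℤₚ.≤? a
... | yes t≤a = ⊥-elim (ℤₚ.<⇒≱ a<t t≤a)
... | no  _   = ≡.refl

-- The step at t leads from time t to t + 1, and a path records the end of each step.
trace : (ℤ → Partition) → List ℤ → List Partition
trace c = map (λ t → c (t ℤ.+ 1ℤ))

map-≡⇒≡ : ∀ {A B : Set} {f g : A → B} {as a} → map f as ≡ map g as → a ∈ as → f a ≡ g a
map-≡⇒≡ eq (here ≡.refl) = Listₚ.∷-injectiveˡ eq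
map-≡⇒≡ eq (there a∈)    = map-≡⇒≡ (Listₚ.∷-injectiveʳ eq) a∈

map-cong-∈ : ∀ {A B : Set} {f g : A → B} as → (∀ {a} → a ∈ as → f a ≡ g a) → map f as ≡ map g as
map-cong-∈ []       f≡g = ≡.refl
map-cong-∈ (a ∷ as) f≡g = ≡.cong₂ _∷_ (f≡g (here ≡.refl)) (map-cong-∈ as (f≡g ∘ there))

module Trajectories (R : RealField) {B : List Partition} (B! : Unique B)
  (rel : ℤ → Partition → Partition → Set) (rel? : ∀ m κ μ → Dec (rel m κ μ))
  (w : ℤ → Partition → Partition → RealField.Carrier R) where
  open RealField R
  open TransferMatrix.Paths R B! rel rel? w

  trace-path : ∀ c a k →
    (∀ {m} → a ℤ.≤ m → m ℤ.< a ℤ.+ + k → rel m (c m) (c (m ℤ.+ 1ℤ)) × c (m ℤ.+ 1ℤ) ∈ B) →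
    IsPath (run a k) (c a) (c (a ℤ.+ + k)) (trace c (run a k))
  trace-path c a zero    h =
    ≡.subst (λ b → IsPath [] (c a) (c b) []) (≡.sym (ℤₚ.+-identityʳ a)) []
  trace-path c a (suc k) h =
    h ℤₚ.≤-refl (+1≤⇒< (ℤₚ.+-monoʳ-≤ a (ℤ.+≤+ (s≤s z≤n)))) ∷
    ≡.subst (λ b → IsPath (run a₁ k) (c a₁) (c b) (trace c (run a₁ k))) (≡.sym (+suc a k))
      (trace-path c (a ℤ.+ 1ℤ) k λ a+1≤m m< →
        h (ℤₚ.<⇒≤ (+1≤⇒< a+1≤m)) (≡.subst (_ ℤ.<_) (≡.sym (+suc a k)) m<))
    where a₁ = a ℤ.+ 1ℤ

  extend-≥ : ∀ {a k s e cs t} → IsPath (run a k) s e cs → a ℤ.+ + k ℤ.≤ t → extend a s cs t ≡ e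
  extend-≥ {a} {zero}  []                            _     = ≡.refl
  extend-≥ {a} {suc k} {s} {cs = c ∷ cs} {t} (_ ∷ path) a+k≤t = ≡.trans
    (extend-> a s c cs (ℤₚ.<-≤-trans (+1≤⇒< (ℤₚ.+-monoʳ-≤ a (ℤ.+≤+ (s≤s z≤n)))) a+k≤t))
    (extend-≥ path (≡.subst (ℤ._≤ t) (+suc a k) a+k≤t))

  extend-rel : ∀ {a k s e cs m} → IsPath (run a k) s e cs → a ℤ.≤ m → m ℤ.< a ℤ.+ + k →
               rel m (extend a s cs m) (extend a s cs (m ℤ.+ 1ℤ))
  extend-rel {a} {zero}  {m = m} path a≤m m< =
    ⊥-elim (ℤₚ.<⇒≱ (≡.subst (m ℤ.<_) (ℤₚ.+-identityʳ a) m<) a≤m)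
  extend-rel {a} {suc k} {s} {cs = c ∷ cs} {m} ((r , _) ∷ path) a≤m m< with a ℤₚ.≟ m
  ... | yes ≡.refl = ≡.subst₂ (rel a) (≡.sym (extend-≤ a s (c ∷ cs) ℤₚ.≤-refl))
    (≡.sym (≡.trans (extend-> a s c cs (≤⇒<+1 ℤₚ.≤-refl)) (extend-≤ (a ℤ.+ 1ℤ) c cs ℤₚ.≤-refl))) r
  ... | no  a≢m    = let a<m = ℤₚ.≤∧≢⇒< a≤m a≢m in
    ≡.subst₂ (rel m) (≡.sym (extend-> a s c cs a<m))
      (≡.sym (extend-> a s c cs (ℤₚ.<-trans a<m (≤⇒<+1 ℤₚ.≤-refl))))
      (extend-rel {k = k} path (<⇒+1≤ a<m) (≡.subst (m ℤ.<_) (+suc a k) m<))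

  trace-extend : ∀ {a k s e cs} → IsPath (run a k) s e cs → trace (extend a s cs) (run a k) ≡ cs
  trace-extend {a} {zero}  []                           = ≡.refl
  trace-extend {a} {suc k} {s} {cs = c ∷ cs} (_ ∷ path) = ≡.cong₂ _∷_
    (≡.trans (extend-> a s c cs (≤⇒<+1 ℤₚ.≤-refl)) (extend-≤ (a ℤ.+ 1ℤ) c cs ℤₚ.≤-refl))
    (≡.trans
      (map-cong-∈ (run (a ℤ.+ 1ℤ) k) (λ t∈ → extend-> a s c cs
        (≤⇒<+1 (ℤₚ.<⇒≤ (+1≤⇒< (proj₁ (∈-run⁻ (a ℤ.+ 1ℤ) k t∈)))))))
      (trace-extend path))

  pathWeight-trace : ∀ c a k →
    pathWeight (run a k) (c a) (trace c (run a k)) ≈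
    ∏-list (run a k) (λ m → w m (c m) (c (m ℤ.+ 1ℤ)))
  pathWeight-trace c a zero    = refl
  pathWeight-trace c a (suc k) = *-congˡ (pathWeight-trace c (a ℤ.+ 1ℤ) k)

-- The sum over pinned configurations as a matrix product

module Process (R : RealField) {n : ℕ} (C : Corners (suc n)) (q : ℤ → RealField.Carrier R)
  (0<q : ∀ t → Corners.uFirst C ℤ.< t → t ℤ.< Corners.uLast C →
         RealField._<_ R (RealField.0# R) (q t))
  (Λ : Fin (suc n) → Partition) {B : List Partition} (B! : Unique B)
  (closed : ∀ {κ μ} → κ ∈ B → μ ⊑ κ → μ ∈ B) (Λ∈ : ∀ i → Λ i ∈ B) where
  open RealField R
  open RealFieldProperties R
  open SetoidReasoning setoid
  open import Algebra.Properties.CommutativeSemigroup *-commutativeSemigroup using (interchange; x∙yz≈y∙xz)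
  open import Algebra.Properties.Semiring.Exp semiring using (^-congʳ; ^-congˡ)
  open import Algebra.Properties.CommutativeSemiring.Exp commutativeSemiring using (^-distrib-*)
  open Corners C
  open CornerProperties C
  open Ensemble R C q
  open TransferMatrix R B!
  open SkewSchur R B! closed
  private
    module ∏ = BigOp *-commutativeMonoid
    module ∑ = BigOp +-commutativeMonoid

  -- The event λ(v_i) = Λ i is imposed on the step that leaves v_i.
  rel : ℤ → Partition → Partition → Set
  rel m κ μ = (D⁻ (m +½) → κ ≺ μ) × (D⁺ (m +½) → κ ≻ μ) × (∀ i → v i ≡ m → κ ≡ Λ i)

  rel? : ∀ m κ μ → Dec (rel m κ μ)
  rel? m κ μ =
    (Finₚ.any? (λ i → (u (inject₁ i) ℤₚ.≤? m) ×-dec (m ℤₚ.<? v i)) →-dec (μ ≻? κ)) ×-dec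
    ((Finₚ.any? (λ i → (v i ℤₚ.≤? m) ×-dec (m ℤₚ.<? u (Fin.suc i))) →-dec (κ ≻? μ)) ×-dec
     Finₚ.all? (λ i → (v i ℤₚ.≟ m) →-dec (κ ≟ₚ Λ i)))

  -- At least one of the truncated differences is 0: w m κ μ = x⁺ ^ (|κ| − |μ|).
  w : ℤ → Kernel
  w m κ μ = x⁻ (m +½) ^ (size μ ℕ.∸ size κ) * x⁺ (m +½) ^ (size κ ℕ.∸ size μ)

  module P = Paths rel rel? w
  open Trajectories R B! rel rel? w

  0<x⁺ : ∀ {m} → uFirst ℤ.≤ m → m ℤ.< uLast → 0# < x⁺ (m +½)
  0<x⁺ {m} u≤m m<u = ∏-positive [ uFirst ℤ.+ 1ℤ , m ℤ.+ 1ℤ ⟩ λ t t∈ →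
    let u+1≤t , t<m+1 = ∈-interval⁻ (ℤₚ.+-monoˡ-≤ 1ℤ u≤m) t∈
    in 0<q t (+1≤⇒< u+1≤t) (ℤₚ.≤-<-trans (<+1⇒≤ t<m+1) m<u)

  ⁻¹^-cancel : ∀ {x} n → ¬ x ≈ 0# → (x ⁻¹) ^ n * x ^ n ≈ 1#
  ⁻¹^-cancel     zero    x≉0 = *-identityˡ 1#
  ⁻¹^-cancel {x} (suc n) x≉0 = trans (interchange _ _ _ _)
    (trans (*-cong (trans (*-comm _ _) (⁻¹-inverseʳ x≉0)) (⁻¹^-cancel n x≉0)) (*-identityˡ 1#))

  -- The integer exponent m - n is split into its negative and positive parts, of which at least one
  -- is 0.
  ^-split : ∀ {x} m n → ¬ x ≈ 0# →
    x ^ m ≈ ((x ⁻¹) ^ (n ℕ.∸ m) * x ^ (m ℕ.∸ n)) * x ^ n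
  ^-split     zero    zero    x≉0 = sym (trans (*-identityʳ _) (*-identityʳ _))
  ^-split     zero    (suc n) x≉0 =
    sym (trans (*-congʳ (*-identityʳ _)) (⁻¹^-cancel (suc n) x≉0))
  ^-split     (suc m) zero    x≉0 = sym (trans (*-identityʳ _) (*-identityˡ _))
  ^-split {x} (suc m) (suc n) x≉0 = trans (*-congˡ (^-split m n x≉0)) (x∙yz≈y∙xz _ _ _)

  w-gauge : ∀ {m} κ μ → uFirst ℤ.≤ m → m ℤ.< uLast →
    x⁺ (m +½) ^ size κ ≈ w m κ μ * x⁺ (m +½) ^ size μ
  w-gauge κ μ u≤m m<u = ^-split (size κ) (size μ) (proj₂ (0<x⁺ u≤m m<u) ∘ sym)

  x⁺-step : ∀ {m} → uFirst ℤ.≤ m → x⁺ ((m ℤ.+ 1ℤ) +½) ≈ x⁺ (m +½) * q (m ℤ.+ 1ℤ)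
  x⁺-step {m} u≤m = begin
    ∏-list [ uFirst ℤ.+ 1ℤ , m ℤ.+ 1ℤ ℤ.+ 1ℤ ⟩ q
      ≡⟨ ≡.cong (λ l → ∏-list l q) (≡.trans
           (interval-++ (ℤₚ.+-monoˡ-≤ 1ℤ u≤m) (ℤₚ.<⇒≤ (≤⇒<+1 ℤₚ.≤-refl)))
           (≡.cong ([ uFirst ℤ.+ 1ℤ , m ℤ.+ 1ℤ ⟩ ++_)
             (≡.trans (interval-∷ (≤⇒<+1 ℤₚ.≤-refl))
                      (≡.cong (m ℤ.+ 1ℤ ∷_) (interval-[] (m ℤ.+ 1ℤ ℤ.+ 1ℤ)))))) ⟩
    ∏-list ([ uFirst ℤ.+ 1ℤ , m ℤ.+ 1ℤ ⟩ ++ (m ℤ.+ 1ℤ ∷ [])) q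
      ≈⟨ ∏.big-++ [ uFirst ℤ.+ 1ℤ , m ℤ.+ 1ℤ ⟩ (m ℤ.+ 1ℤ ∷ []) q ⟩
    x⁺ (m +½) * (q (m ℤ.+ 1ℤ) * 1#)
      ≈⟨ *-congˡ (*-identityʳ _) ⟩
    x⁺ (m +½) * q (m ℤ.+ 1ℤ)  ∎

  -- Summation by parts in the exponents, since x⁺ (m + 1) / x⁺ m = q (m + 1).
  gauge : ∀ (c : ℤ → Partition) m k → uFirst ℤ.≤ m → m ℤ.+ + k ℤ.< uLast →
    x⁺ (m +½) ^ size (c m) * ∏-list (run (m ℤ.+ 1ℤ) k) (λ t → q t ^ size (c t)) ≈
    ∏-list (run m (suc k)) (λ t → w t (c t) (c (t ℤ.+ 1ℤ))) *
      x⁺ ((m ℤ.+ + k) +½) ^ size (c (m ℤ.+ + k ℤ.+ 1ℤ))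
  gauge c m zero    u≤m m<u = begin
    x⁺ (m +½) ^ size (c m) * 1#
      ≈⟨ *-identityʳ _ ⟩
    x⁺ (m +½) ^ size (c m)
      ≈⟨ w-gauge (c m) (c (m ℤ.+ 1ℤ)) u≤m (≡.subst (ℤ._< uLast) (ℤₚ.+-identityʳ m) m<u) ⟩
    w m (c m) (c (m ℤ.+ 1ℤ)) * x⁺ (m +½) ^ size (c (m ℤ.+ 1ℤ))
      ≈⟨ *-congʳ (*-identityʳ _) ⟨
    (w m (c m) (c (m ℤ.+ 1ℤ)) * 1#) * x⁺ (m +½) ^ size (c (m ℤ.+ 1ℤ))
      ≡⟨ ≡.cong (λ l → (w m (c m) (c (m ℤ.+ 1ℤ)) * 1#) * x⁺ (l +½) ^ size (c (l ℤ.+ 1ℤ)))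
                (ℤₚ.+-identityʳ m) ⟨
    (w m (c m) (c (m ℤ.+ 1ℤ)) * 1#) * x⁺ ((m ℤ.+ + 0) +½) ^ size (c (m ℤ.+ + 0 ℤ.+ 1ℤ))  ∎
  gauge c m (suc k) u≤m m<u = begin
    x⁺ (m +½) ^ size (c m) * (q m₁ ^ size (c m₁) * rest)
      ≈⟨ *-congʳ (w-gauge (c m) (c m₁) u≤m (ℤₚ.≤-<-trans (a≤a+k m (suc k)) m<u)) ⟩
    (w m (c m) (c m₁) * x⁺ (m +½) ^ size (c m₁)) * (q m₁ ^ size (c m₁) * rest)
      ≈⟨ *-assoc _ _ _ ⟩
    w m (c m) (c m₁) * (x⁺ (m +½) ^ size (c m₁) * (q m₁ ^ size (c m₁) * rest))
      -- The slice weight turns the power of x⁺ left by this step into the power of the next x⁺,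
      -- which is the boundary factor required by the induction.
      ≈⟨ *-congˡ (trans (sym (*-assoc _ _ _)) (*-congʳ (trans
           (sym (^-distrib-* _ _ (size (c m₁)))) (^-congˡ (size (c m₁)) (sym (x⁺-step u≤m)))))) ⟩
    w m (c m) (c m₁) * (x⁺ (m₁ +½) ^ size (c m₁) * rest)
      ≈⟨ *-congˡ (gauge c m₁ k (ℤₚ.≤-trans u≤m (ℤₚ.<⇒≤ (≤⇒<+1 ℤₚ.≤-refl)))
                   (≡.subst (ℤ._< uLast) (+suc m k) m<u)) ⟩
    w m (c m) (c m₁) * (∏-list (run m₁ (suc k)) (λ t → w t (c t) (c (t ℤ.+ 1ℤ))) *
      x⁺ ((m₁ ℤ.+ + k) +½) ^ size (c (m₁ ℤ.+ + k ℤ.+ 1ℤ)))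
      ≈⟨ *-assoc _ _ _ ⟨
    ∏-list (run m (suc (suc k))) (λ t → w t (c t) (c (t ℤ.+ 1ℤ))) *
      x⁺ ((m₁ ℤ.+ + k) +½) ^ size (c (m₁ ℤ.+ + k ℤ.+ 1ℤ))
      ≡⟨ ≡.cong (λ l → ∏-list (run m (suc (suc k))) (λ t → w t (c t) (c (t ℤ.+ 1ℤ))) *
                       x⁺ (l +½) ^ size (c (l ℤ.+ 1ℤ))) (+suc m k) ⟨
    ∏-list (run m (suc (suc k))) (λ t → w t (c t) (c (t ℤ.+ 1ℤ))) *
      x⁺ ((m ℤ.+ + suc k) +½) ^ size (c (m ℤ.+ + suc k ℤ.+ 1ℤ))  ∎
    where
    m₁ = m ℤ.+ 1ℤ
    rest = ∏-list (run (m₁ ℤ.+ 1ℤ) k) (λ t → q t ^ size (c t))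

  uFirst<uLast : uFirst ℤ.< uLast
  uFirst<uLast = ℤₚ.<-trans (uFirst<v Fin.zero) (v<uLast Fin.zero)

  weight-steps : ∀ c → weight c ≈ ∏-list steps (λ m → w m (slice c m) (slice c (m ℤ.+ 1ℤ)))
  -- `k` counts the times strictly between the end corners; there are `k` + 1 steps. Both boundary
  -- factors of `gauge` have exponent `size ∅`.
  weight-steps c with k , uLast≡ ← offset (<⇒+1≤ uFirst<uLast) = begin
    ∏-list [ uFirst ℤ.+ 1ℤ , uLast ⟩ qw
      ≡⟨ ≡.cong (λ l → ∏-list l qw)
           (≡.trans (≡.cong [ uFirst ℤ.+ 1ℤ ,_⟩ uLast≡) (interval-run (uFirst ℤ.+ 1ℤ) k)) ⟩
    ∏-list (run (uFirst ℤ.+ 1ℤ) k) qw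
      ≈⟨ trans (*-congʳ (^-congʳ (x⁺ (uFirst +½)) (≡.cong size (empty-≤ c uFirst ℤₚ.≤-refl))))
               (*-identityˡ _) ⟨
    x⁺ (uFirst +½) ^ size (slice c uFirst) * ∏-list (run (uFirst ℤ.+ 1ℤ) k) qw
      ≈⟨ gauge (slice c) uFirst k ℤₚ.≤-refl (+1≤⇒< (ℤₚ.≤-reflexive (≡.sym uLast≡′))) ⟩
    ∏-list (run uFirst (suc k)) ww * x⁺ ((uFirst ℤ.+ + k) +½) ^ size (slice c (uFirst ℤ.+ + k ℤ.+ 1ℤ))
      ≈⟨ trans (*-congˡ (^-congʳ (x⁺ ((uFirst ℤ.+ + k) +½)) (≡.cong size
           (empty-≥ c (uFirst ℤ.+ + k ℤ.+ 1ℤ) (ℤₚ.≤-reflexive uLast≡′))))) (*-identityʳ _) ⟩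
    ∏-list (run uFirst (suc k)) ww
      ≡⟨ ≡.cong (λ l → ∏-list l ww) (≡.trans
           (≡.cong [ uFirst ,_⟩ (≡.trans uLast≡ (≡.sym (+suc uFirst k))))
           (interval-run uFirst (suc k))) ⟨
    ∏-list steps ww  ∎
    where
    qw = λ t → q t ^ size (slice c t)
    ww = λ m → w m (slice c m) (slice c (m ℤ.+ 1ℤ))
    uLast≡′ : uLast ≡ uFirst ℤ.+ + k ℤ.+ 1ℤ
    uLast≡′ = ≡.trans uLast≡ (≡.trans (ℤₚ.+-assoc uFirst 1ℤ (+ k))
      (≡.trans (≡.cong (λ e → uFirst ℤ.+ e) (ℤₚ.+-comm 1ℤ (+ k))) (≡.sym (ℤₚ.+-assoc uFirst (+ k) 1ℤ))))

  Pinned : Configuration → Set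
  Pinned c = ∀ i → slice c (v i) ≡ Λ i

  code : Configuration → List Partition
  code c = trace (slice c) steps

  module _ {c : Configuration} (pin : Pinned c) where

    private
      -- Induction on the distance to `v i`: on this stretch each slice is contained in the next, up
      -- to the pinned one. The descending stretch after `v i` is treated likewise in `above`.
      below : ∀ i k {t} → u (inject₁ i) ℤ.≤ t → t ℤ.+ + k ≡ v i → slice c t ∈ B
      below i zero    {t} u≤t t≡v =
        ≡.subst (_∈ B) (≡.sym (≡.trans (≡.cong (slice c)
          (≡.trans (≡.sym (ℤₚ.+-identityʳ t)) t≡v)) (pin i))) (Λ∈ i)
      below i (suc k) {t} u≤t t+k≡v = closed
        (below i k {t ℤ.+ 1ℤ} (ℤₚ.≤-trans u≤t (ℤₚ.<⇒≤ (≤⇒<+1 ℤₚ.≤-refl)))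
          (≡.trans (≡.sym (+suc t k)) t+k≡v))
        (≻⇒⊒ {slice c (t ℤ.+ 1ℤ)} {slice c t}
          (proj₁ (interlace c (t +½) (ℤₚ.≤-trans (uFirst≤ (inject₁ i)) u≤t)
                                     (ℤₚ.<-trans t<v (v<uLast i))) (i , u≤t , t<v)))
        where
        t<v : t ℤ.< v i
        t<v = ≡.subst (t ℤ.<_) t+k≡v (+1≤⇒< (ℤₚ.+-monoʳ-≤ t (ℤ.+≤+ (s≤s z≤n))))

      above : ∀ i k → v i ℤ.+ + k ℤ.≤ u (Fin.suc i) → slice c (v i ℤ.+ + k) ∈ B
      above i zero    _    = ≡.subst (_∈ B)
        (≡.sym (≡.trans (≡.cong (slice c) (ℤₚ.+-identityʳ (v i))) (pin i))) (Λ∈ i)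
      above i (suc k) v+k≤u = ≡.subst (λ t → slice c t ∈ B) t+1≡ (closed
        (above i k (ℤₚ.<⇒≤ t<u))
        (≻⇒⊒ {slice c t} {slice c (t ℤ.+ 1ℤ)}
          (proj₂ (interlace c (t +½) (ℤₚ.≤-trans (ℤₚ.<⇒≤ (uFirst<v i)) (a≤a+k (v i) k))
                   (ℤₚ.<-≤-trans t<u (≤uLast (Fin.suc i)))) (i , a≤a+k (v i) k , t<u))))
        where
        t = v i ℤ.+ + k
        t+1≡ : t ℤ.+ 1ℤ ≡ v i ℤ.+ + suc k
        t+1≡ = ≡.trans (ℤₚ.+-assoc (v i) (+ k) 1ℤ) (≡.cong (λ e → v i ℤ.+ e) (ℤₚ.+-comm (+ k) 1ℤ))
        t<u : t ℤ.< u (Fin.suc i)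
        t<u = +1≤⇒< (≡.subst (ℤ._≤ u (Fin.suc i)) (≡.sym t+1≡) v+k≤u)

      ∅∈ : ∅ ∈ B
      ∅∈ = closed (Λ∈ Fin.zero) (λ i → z≤n)

    slice-∈ : ∀ t → slice c t ∈ B
    slice-∈ t with t ℤₚ.≤? uFirst
    ... | yes t≤u = ≡.subst (_∈ B) (≡.sym (empty-≤ c t t≤u)) ∅∈
    ... | no  t≰u with uLast ℤₚ.≤? t
    ...   | yes u≤t = ≡.subst (_∈ B) (≡.sym (empty-≥ c t u≤t)) ∅∈
    ...   | no  u≰t with in-piece (ℤₚ.<⇒≤ (ℤₚ.≰⇒> t≰u)) (ℤₚ.≰⇒> u≰t)
    ...     | i , inj₁ (u≤t , t<v) = let k , v≡ = offset (ℤₚ.<⇒≤ t<v) in below i k u≤t (≡.sym v≡)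
    ...     | i , inj₂ (v≤t , t<u) = let k , t≡ = offset v≤t in
      ≡.subst (λ t → slice c t ∈ B) (≡.sym t≡) (above i k (≡.subst (ℤ._≤ _) t≡ (ℤₚ.<⇒≤ t<u)))

    code-path : P.IsPath steps ∅ ∅ (code c)
    code-path with k , eq ← offset uFirst≤uLast =
      ≡.subst (λ ls → P.IsPath ls ∅ ∅ (trace (slice c) ls))
        (≡.sym (≡.trans (≡.cong [ uFirst ,_⟩ eq) (interval-run uFirst k)))
        (≡.subst₂ (λ s e → P.IsPath (run uFirst k) s e (trace (slice c) (run uFirst k)))
          (empty-≤ c uFirst ℤₚ.≤-refl) (empty-≥ c (uFirst ℤ.+ + k) (ℤₚ.≤-reflexive eq))
          (trace-path (slice c) uFirst k λ {m} u≤m m< →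
            let r = interlace c (m +½) u≤m (≡.subst (m ℤ.<_) (≡.sym eq) m<)
            in (proj₁ r , proj₂ r , λ { i ≡.refl → pin i }) , slice-∈ (m ℤ.+ 1ℤ)))

  -- Outside the open interval both configurations are empty; inside, time t is the end of the step
  -- at t - 1.
  code-injective : ∀ {c d} → code c ≡ code d → ∀ t → slice c t ≡ slice d t
  code-injective {c} {d} eq t with t ℤₚ.≤? uFirst
  ... | yes t≤u = ≡.trans (empty-≤ c t t≤u) (≡.sym (empty-≤ d t t≤u))
  ... | no  t≰u with uLast ℤₚ.≤? t
  ...   | yes u≤t = ≡.trans (empty-≥ c t u≤t) (≡.sym (empty-≥ d t u≤t))
  ...   | no  u≰t = ≡.subst (λ t → slice c t ≡ slice d t) t-1+1≡t
    (map-≡⇒≡ {f = λ t → slice c (t ℤ.+ 1ℤ)} {λ t → slice d (t ℤ.+ 1ℤ)} eq (∈-interval⁺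
      (<+1⇒≤ {b = ℤ.pred t} (≡.subst (uFirst ℤ.<_) (≡.sym t-1+1≡t) (ℤₚ.≰⇒> t≰u)))
      (ℤₚ.<-trans (+1≤⇒< {ℤ.pred t} (ℤₚ.≤-reflexive t-1+1≡t)) (ℤₚ.≰⇒> u≰t))))
    where
    t-1+1≡t : ℤ.pred t ℤ.+ 1ℤ ≡ t
    t-1+1≡t = ≡.trans (ℤₚ.+-comm (ℤ.pred t) 1ℤ) (ℤₚ.suc-pred t)

  decode : ∀ {νs} → P.IsPath steps ∅ ∅ νs → ∃[ c ] (Pinned c × code c ≡ νs)
  decode {νs} path with k , eq ← offset uFirst≤uLast
    with steps≡ ← ≡.trans (≡.cong [ uFirst ,_⟩ eq) (interval-run uFirst k)
    with path′ ← ≡.subst (λ ls → P.IsPath ls ∅ ∅ νs) steps≡ path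
    = record
      { slice     = c
      ; empty-≤   = λ t → extend-≤ uFirst ∅ νs
      ; empty-≥   = λ t u≤t → extend-≥ path′ (≡.subst (ℤ._≤ t) eq u≤t)
      ; interlace = λ m u≤m m<u → let r⁻ , r⁺ , _ = related u≤m m<u in r⁻ , r⁺
      }
    , (λ i → proj₂ (proj₂ (related (ℤₚ.<⇒≤ (uFirst<v i)) (v<uLast i))) i ≡.refl)
    , ≡.trans (≡.cong (trace c) steps≡) (trace-extend path′)
    where
    c = extend uFirst ∅ νs
    related : ∀ {m} → uFirst ℤ.≤ m → m ℤ.< uLast → rel m (c m) (c (m ℤ.+ 1ℤ))
    related {m} u≤m m<u = extend-rel path′ u≤m (≡.subst (m ℤ.<_) eq m<u)

  weight-code : ∀ c → weight c ≈ P.pathWeight steps ∅ (code c)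
  weight-code c with k , eq ← offset uFirst≤uLast = begin
    weight c
      ≈⟨ weight-steps c ⟩
    ∏-list steps ww
      ≡⟨ ≡.cong (λ l → ∏-list l ww) steps≡ ⟩
    ∏-list (run uFirst k) ww
      ≈⟨ pathWeight-trace (slice c) uFirst k ⟨
    P.pathWeight (run uFirst k) (slice c uFirst) (trace (slice c) (run uFirst k))
      ≡⟨ ≡.cong₂ (λ s ls → P.pathWeight ls s (trace (slice c) ls))
           (empty-≤ c uFirst ℤₚ.≤-refl) (≡.sym steps≡) ⟩
    P.pathWeight steps ∅ (code c)  ∎
    where
    ww = λ m → w m (slice c m) (slice c (m ℤ.+ 1ℤ))
    steps≡ = ≡.trans (≡.cong [ uFirst ,_⟩ eq) (interval-run uFirst k)

  ∑⁺-configurations : ∑⁺ configurations Pinned weight ≈ pathSum (map P.transfer steps) ∅ ∅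
  ∑⁺-configurations = trans
    (∑⁺-enumerate configurations Pinned weight code (P.pathWeight steps ∅)
      (P.paths steps ∅ ∅) (P.paths-unique steps ∅ ∅)
      (λ c≈d → map-cong-∈ steps (λ {t} _ → c≈d (t ℤ.+ 1ℤ)))
      (λ {c} {d} _ _ → code-injective {c} {d})
      (λ {c} _ → ∏-nonNeg [ uFirst ℤ.+ 1ℤ , uLast ⟩ λ t t∈ →
        let u+1≤t , t<u = ∈-interval⁻ (<⇒+1≤ uFirst<uLast) t∈
        in ^-nonNeg (size (slice c t)) (proj₁ (0<q t (+1≤⇒< u+1≤t) t<u)))
      (λ {c} _ → weight-code c)
      (λ {c} pin → inj₁ (P.∈-paths⁺ (code-path {c} pin)))
      (λ νs∈ → decode (P.∈-paths⁻ steps νs∈)))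
    (P.∑-paths steps ∅ ∅)

  -- Rank-one factorisation of the stretches and the Schur process

  kernel⁻ kernel⁺ : ℤ → Kernel
  kernel⁻ m = Chain.transfer (x⁻ (m +½))
  kernel⁺ m = flip (Chain.transfer (x⁺ (m +½)))

  transfer⁻ : ∀ i {m} → u (inject₁ i) ℤ.≤ m → m ℤ.< v i →
              ∀ κ μ → P.transfer m κ μ ≈ kernel⁻ m κ μ
  transfer⁻ i {m} u≤m m<v κ μ = ∑.when-cong (rel? m κ μ) (μ ≻? κ)
    (λ (r , _) → r m∈D⁻)
    (λ κ≺μ → (λ _ → κ≺μ) , (λ m∈D⁺ → ⊥-elim (D⁻∩D⁺≡∅ {m +½} m∈D⁻ m∈D⁺))
           -- A pinned step starts at some `v j`, and its half-integer v_j + ½ lies in D⁺; a step in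
           -- D⁻ is therefore never pinned.
           , λ { j ≡.refl → ⊥-elim (D⁻∩D⁺≡∅ {m +½} m∈D⁻ (j , ℤₚ.≤-refl , v<u j)) })
    (λ (r , _) → trans (*-congˡ (^-congʳ _ (ℕₚ.m≤n⇒m∸n≡0
      (size-mono {κ} {μ} (≻⇒⊒ {μ} {κ} (r m∈D⁻)))))) (*-identityʳ _))
    where
    m∈D⁻ : D⁻ (m +½)
    m∈D⁻ = i , u≤m , m<v

  transfer⁺ : ∀ i {m} → v i ℤ.≤ m → m ℤ.< u (Fin.suc i) → ∀ κ μ → (v i ≡ m → κ ≡ Λ i) →
              P.transfer m κ μ ≈ kernel⁺ m κ μ
  transfer⁺ i {m} v≤m m<u κ μ pin = ∑.when-cong (rel? m κ μ) (κ ≻? μ)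
    (λ (_ , r , _) → r m∈D⁺)
    (λ κ≻μ → (λ m∈D⁻ → ⊥-elim (D⁻∩D⁺≡∅ {m +½} m∈D⁻ m∈D⁺)) , (λ _ → κ≻μ) , pinned)
    (λ (_ , r , _) → trans (*-congʳ (^-congʳ _ (ℕₚ.m≤n⇒m∸n≡0
      (size-mono {μ} {κ} (≻⇒⊒ {κ} {μ} (r m∈D⁺)))))) (*-identityˡ _))
    where
    m∈D⁺ : D⁺ (m +½)
    m∈D⁺ = i , v≤m , m<u
    pinned : ∀ j → v j ≡ m → κ ≡ Λ j
    pinned j vj≡m with ≡.refl ← D⁺-unique v≤m m<u (ℤₚ.≤-reflexive vj≡m)
                                  (≡.subst (ℤ._< u (Fin.suc j)) vj≡m (v<u j)) = pin vj≡m

  transfer-pin : ∀ i κ μ → κ ≢ Λ i → P.transfer (v i) κ μ ≈ 0#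
  transfer-pin i κ μ κ≢Λ = ∑.when-no (rel? (v i) κ μ) (λ (_ , _ , p) → κ≢Λ (p i ≡.refl))

  pathSum⁻ : ∀ i κ {μ} → μ ∈ B →
    pathSum (map P.transfer [ u (inject₁ i) , v i ⟩) κ μ ≈ skewSchur R μ κ (X⁻ i)
  pathSum⁻ i κ {μ} μ∈ = begin
    pathSum (map P.transfer ms) κ μ
      ≈⟨ pathSum-cong ms (λ m∈ → let u≤m , m<v = ∈-interval⁻ (ℤₚ.<⇒≤ (u<v i)) m∈
                                 in transfer⁻ i u≤m m<v) κ μ ⟩
    pathSum (map kernel⁻ ms) κ μ
      ≡⟨ ≡.cong (λ ks → pathSum ks κ μ)
           (≡.trans (Listₚ.map-∘ ms) (Listₚ.map-∘ (map _+½ ms))) ⟩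
    pathSum (map Chain.transfer (X⁻ i)) κ μ
      ≈⟨ skewSchur-pathSum κ (X⁻ i) μ∈ ⟨
    skewSchur R μ κ (X⁻ i)  ∎
    where ms = [ u (inject₁ i) , v i ⟩

  -- Slices shrink along D⁺, so the stretch is an increasing chain from μ to κ read backwards. This
  -- is the reversal built into `X⁺`.
  pathSum⁺-unpinned : ∀ i {κ μ} → κ ∈ B → μ ∈ B →
    pathSum (map kernel⁺ [ v i , u (Fin.suc i) ⟩) κ μ ≈ skewSchur R κ μ (X⁺ i)
  pathSum⁺-unpinned i {κ} {μ} κ∈ μ∈ = begin
    pathSum (map kernel⁺ ms) κ μ
      ≈⟨ pathSum-reverse (λ m → Chain.transfer (x⁺ (m +½))) ms μ∈ κ∈ ⟨
    pathSum (map (λ m → Chain.transfer (x⁺ (m +½))) (reverse ms)) μ κ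
      ≡⟨ ≡.cong (λ ks → pathSum ks μ κ) (≡.trans (Listₚ.map-∘ (reverse ms))
           (≡.trans (Listₚ.map-∘ (map _+½ (reverse ms)))
             (≡.cong (map Chain.transfer ∘ map x⁺) (Listₚ.reverse-map _+½ ms)))) ⟩
    pathSum (map Chain.transfer (X⁺ i)) μ κ
      ≈⟨ skewSchur-pathSum μ (X⁺ i) κ∈ ⟨
    skewSchur R κ μ (X⁺ i)  ∎
    where ms = [ v i , u (Fin.suc i) ⟩

  -- Within this stretch only the first step, the one leaving `v i`, is pinned. Its condition
  -- concerns the starting slice alone, so it factors out as `δ`.
  pathSum⁺ : ∀ i {κ μ} → κ ∈ B → μ ∈ B →
    pathSum (map P.transfer [ v i , u (Fin.suc i) ⟩) κ μ ≈ δ (Λ i) κ * skewSchur R κ μ (X⁺ i)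
  pathSum⁺ i {κ} {μ} κ∈ μ∈ = begin
    pathSum (map P.transfer ms) κ μ
      ≡⟨ ≡.cong (λ l → pathSum (map P.transfer l) κ μ) (interval-∷ (v<u i)) ⟩
    ∑-list B (λ ν → P.transfer (v i) κ ν * pathSum (map P.transfer ms′) ν μ)
      ≈⟨ ∑.big-cong B (λ ν _ → trans
           (*-cong (first ν) (pathSum-cong ms′ (λ m∈ κ μ → rest m∈ κ μ) ν μ)) (*-assoc _ _ _)) ⟩
    ∑-list B (λ ν → δ (Λ i) κ * (kernel⁺ (v i) κ ν * pathSum (map kernel⁺ ms′) ν μ))
      ≈⟨ *-∑ R (δ (Λ i) κ) B _ ⟨
    δ (Λ i) κ * pathSum (map kernel⁺ (v i ∷ ms′)) κ μ
      ≡⟨ ≡.cong (λ l → δ (Λ i) κ * pathSum (map kernel⁺ l) κ μ) (interval-∷ (v<u i)) ⟨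
    δ (Λ i) κ * pathSum (map kernel⁺ ms) κ μ
      ≈⟨ *-congˡ (pathSum⁺-unpinned i κ∈ μ∈) ⟩
    δ (Λ i) κ * skewSchur R κ μ (X⁺ i)  ∎
    where
    ms  = [ v i , u (Fin.suc i) ⟩
    ms′ = [ v i ℤ.+ 1ℤ , u (Fin.suc i) ⟩
    rest : ∀ {m} → m ∈ ms′ → ∀ κ μ → P.transfer m κ μ ≈ kernel⁺ m κ μ
    rest m∈ κ μ = let v+1≤m , m<u = ∈-interval⁻ (<⇒+1≤ (v<u i)) m∈ ; v<m = +1≤⇒< v+1≤m in
      transfer⁺ i (ℤₚ.<⇒≤ v<m) m<u κ μ (λ v≡m → ⊥-elim (ℤₚ.<⇒≢ v<m v≡m))
    first : ∀ ν → P.transfer (v i) κ ν ≈ δ (Λ i) κ * kernel⁺ (v i) κ ν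
    first ν = by-pin (κ ≟ₚ Λ i)
      where
      by-pin : Dec (κ ≡ Λ i) → P.transfer (v i) κ ν ≈ δ (Λ i) κ * kernel⁺ (v i) κ ν
      by-pin (yes κ≡Λ) = trans (transfer⁺ i ℤₚ.≤-refl (v<u i) κ ν (λ _ → κ≡Λ))
        (sym (trans (*-congʳ (∑.when-yes (Λ i ≟ₚ κ) (≡.sym κ≡Λ))) (*-identityˡ _)))
      by-pin (no κ≢Λ) = trans (transfer-pin i κ ν κ≢Λ)
        (sym (trans (*-congʳ (∑.when-no (Λ i ≟ₚ κ) (κ≢Λ ∘ ≡.sym))) (zeroˡ _)))

  -- The `δ` from the pin collapses the sum over the slice at `v i` to `Λ i`, which separates the
  -- dependence on κ from that on μ.
  pathSum-piece : ∀ i {κ μ} → κ ∈ B → μ ∈ B →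
    pathSum (map P.transfer (pieces i)) κ μ ≈
    skewSchur R (Λ i) κ (X⁻ i) * skewSchur R (Λ i) μ (X⁺ i)
  pathSum-piece i {κ} {μ} κ∈ μ∈ = begin
    pathSum (map P.transfer (pieces i)) κ μ
      ≡⟨ ≡.cong (λ ks → pathSum ks κ μ) (Listₚ.map-++ P.transfer [ u (inject₁ i) , v i ⟩ _) ⟩
    pathSum (map P.transfer [ u (inject₁ i) , v i ⟩ ++ map P.transfer [ v i , u (Fin.suc i) ⟩) κ μ
      ≈⟨ pathSum-++ (map P.transfer [ u (inject₁ i) , v i ⟩) κ∈ ⟩
    ∑-list B (λ ν → pathSum (map P.transfer [ u (inject₁ i) , v i ⟩) κ ν *
                    pathSum (map P.transfer [ v i , u (Fin.suc i) ⟩) ν μ)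
      ≈⟨ ∑.big-cong B (λ ν ν∈ → trans (*-cong (pathSum⁻ i κ ν∈) (pathSum⁺ i ν∈ μ∈))
                                      (x∙yz≈y∙xz _ _ _)) ⟩
    ∑-list B (λ ν → δ (Λ i) ν * (skewSchur R ν κ (X⁻ i) * skewSchur R ν μ (X⁺ i)))
      ≈⟨ ∑-δˡ (λ ν → skewSchur R ν κ (X⁻ i) * skewSchur R ν μ (X⁺ i)) (Λ∈ i) ⟩
    skewSchur R (Λ i) κ (X⁻ i) * skewSchur R (Λ i) μ (X⁺ i)  ∎

  skewSchur-zero : ∀ {κ μ} xs → ¬ μ ⊆ κ → skewSchur R κ μ xs ≈ 0#
  skewSchur-zero {κ} {μ} xs μ⊈κ with μ ⊆? κ
  ... | yes μ⊆κ = ⊥-elim (μ⊈κ μ⊆κ)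
  ... | no  _   = refl

  skewSchur-nonNeg : ∀ κ μ xs → (∀ {x} → x ∈ xs → 0# ≤ x) → 0# ≤ skewSchur R κ μ xs
  skewSchur-nonNeg κ μ xs 0≤x with μ ⊆? κ
  ... | yes _ = ∑-nonNeg (tableaux κ μ (List.length xs)) (λ T _ →
                  ∏-nonNeg (Vec.toList T) (λ a _ → 0≤x (∈-lookup a)))
  ... | no  _ = IsTotalOrder.refl isTotalOrder

  0<x⁺-on : ∀ {a b m} → uFirst ℤ.≤ a → a ℤ.≤ b → b ℤ.≤ uLast → m ∈ halfIntegers a b → 0# < x⁺ m
  0<x⁺-on u≤a a≤b b≤u m∈ with _ , t∈ , ≡.refl ← ∈-map⁻ _+½ m∈ =
    let a≤t , t<b = ∈-interval⁻ a≤b t∈ in 0<x⁺ (ℤₚ.≤-trans u≤a a≤t) (ℤₚ.<-≤-trans t<b b≤u)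

  X⁻-nonNeg : ∀ i {x} → x ∈ X⁻ i → 0# ≤ x
  X⁻-nonNeg i x∈ with _ , m∈ , ≡.refl ← ∈-map⁻ x⁻ x∈ = ⁻¹-nonNeg
    (0<x⁺-on (uFirst≤ (inject₁ i)) (ℤₚ.<⇒≤ (u<v i)) (ℤₚ.<⇒≤ (v<uLast i)) m∈)

  X⁺-nonNeg : ∀ i {x} → x ∈ X⁺ i → 0# ≤ x
  X⁺-nonNeg i x∈ with _ , m∈ , ≡.refl ← ∈-map⁻ x⁺ x∈ = proj₁
    (0<x⁺-on (ℤₚ.<⇒≤ (uFirst<v i)) (ℤₚ.<⇒≤ (v<u i)) (≤uLast (Fin.suc i)) (Anyₚ.reverse⁻ m∈))

  -- The summand vanishes unless ν is contained in `Λ i`, and such ν lie in the ideal `B`.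
  -- Nonnegativity of the parameters makes the supremum a genuine sum.
  ∑⁺-partitions : ∀ i j →
    ∑⁺ partitions U (λ ν → skewSchur R (Λ i) ν (X⁺ i) * skewSchur R (Λ j) ν (X⁻ j)) ≈
    ∑-list B (λ ν → skewSchur R (Λ i) ν (X⁺ i) * skewSchur R (Λ j) ν (X⁻ j))
  ∑⁺-partitions i j = ∑⁺-enumerate partitions U f id f B B! id (λ _ _ → id)
    (λ {ν} _ → *-nonNeg (skewSchur-nonNeg (Λ i) ν (X⁺ i) (X⁺-nonNeg i))
                        (skewSchur-nonNeg (Λ j) ν (X⁻ j) (X⁻-nonNeg j)))
    (λ _ → refl) (λ {ν} _ → support ν) (λ {ν} _ → ν , tt , ≡.refl)
    where
    f = λ ν → skewSchur R (Λ i) ν (X⁺ i) * skewSchur R (Λ j) ν (X⁻ j)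
    support : ∀ ν → ν ∈ B ⊎ f ν ≈ 0#
    support ν = by-⊆ (ν ⊆? Λ i)
      where
      by-⊆ : Dec (ν ⊆ Λ i) → ν ∈ B ⊎ f ν ≈ 0#
      by-⊆ (yes ν⊆Λ) = inj₁ (closed (Λ∈ i) (⊆⇒⊑ {ν} {Λ i} ν⊆Λ))
      by-⊆ (no  ν⊈Λ) = inj₂ (trans (*-congʳ (skewSchur-zero {Λ i} {ν} (X⁺ i) ν⊈Λ)) (zeroˡ _))

  ∅-∈ : ∅ ∈ B
  ∅-∈ = closed (Λ∈ Fin.zero) (λ i → z≤n)

  -- Both ends of the path are `∅`, so the two outer vectors of the rank-one product become ordinary
  -- Schur polynomials.
  schur-process : ∑⁺ configurations Pinned weight ≈
    schur R (Λ Fin.zero) (X⁻ Fin.zero)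
      * (∏-list (allFin n) (λ i → ∑⁺ partitions U (λ ν →
           skewSchur R (Λ (inject₁ i)) ν (X⁺ (inject₁ i))
             * skewSchur R (Λ (Fin.suc i)) ν (X⁻ (Fin.suc i))))
      * schur R (Λ (fromℕ n)) (X⁺ (fromℕ n)))
  schur-process = begin
    ∑⁺ configurations Pinned weight
      ≈⟨ ∑⁺-configurations ⟩
    pathSum (map P.transfer steps) ∅ ∅
      ≡⟨ ≡.cong (λ l → pathSum (map P.transfer l) ∅ ∅) steps-concat ⟩
    pathSum (map P.transfer (concat (tabulate pieces))) ∅ ∅
      ≈⟨ pathSum-rank-one P.transfer pieces _ _ pathSum-piece ∅-∈ ∅-∈ ⟩
    _ ≈⟨ *-congˡ (*-congʳ (∏.big-cong (allFin n) (λ i _ → ∑⁺-partitions (inject₁ i) (Fin.suc i)))) ⟨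
    _ ∎

open import Data.Fin using (zero; suc)

mainTheorem1 :
  (R : RealField) (n : ℕ) (C : Corners (suc n)) →
  let open RealField R
      open Corners C in
  (q : ℤ → Carrier) →
  (∀ t → uFirst ℤ.< t → t ℤ.< uLast → 0# < q t × q t < 1#) →
  let open Ensemble R C q in
  (Λ : Fin (suc n) → Partition) →
  Prob (λ c → ∀ i → slice c (v i) ≡ Λ i)
    ≈ 1# / Z
      * (schur R (Λ zero) (X⁻ zero)
      * (∏-list (allFin n) (λ i →
           ∑⁺ partitions U (λ ν →
             skewSchur R (Λ (inject₁ i)) ν (X⁺ (inject₁ i))
               * skewSchur R (Λ (suc i)) ν (X⁻ (suc i))))
      * schur R (Λ (fromℕ n)) (X⁺ (fromℕ n))))
mainTheorem1 R n C q q-bounds Λ =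
  let B , B! , closed , Λ∈ = finite-ideal (allFin (suc n)) Λ
      open Process R C q (λ t u<t t<u → proj₁ (q-bounds t u<t t<u)) Λ B! closed
                   (λ i → Λ∈ (∈-allFin i))
      open RealField R
  -- `Prob` is the numerator times `Z ⁻¹`; moving that factor to the front leaves exactly the
  -- identity for the numerator.
  in trans (*-comm _ _) (*-cong (sym (*-identityˡ _)) schur-process)
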